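{- Let $H$ be a finite ordered $3$-uniform hypergraph from which isolated vertices have been deleted, and let $\widetilde H$ be its bounded-occurrence compilation. Then $$\mathrm{NCF}(e_{\widetilde H})=\mathrm{NCF}(e_H).$$ The compiled hypergraph $\widetilde H$ is simple and $3$-uniform. Every occurrence copy has degree at most seven in $\widetilde H$ and every auxiliary vertex has degree four. If a proper two-colouring of $H$ is supplied, a proper two-colouring of $\widetilde H$ is computable in linear time.
   Context: Hyperedges of an ordered $3$-uniform hypergraph are ordered triples of distinct vertices; the degree of a vertex is the number of hyperedges containing it; "simple" means no two hyperedges have the same vertex set. A proper two-colouring is a $\{0,1\}$-colouring of the vertices nonconstant on every hyperedge. Equality gadget: for terminals $x,y$ and fresh auxiliary variables $a,b,c$, $\mathcal Q(x,y;a,b,c)$ consists of the six hyperedges $(x,a,b),(x,a,c),(x,b,c),(y,a,b),(y,a,c),(y,b,c)$. Bounded-occurrence compilation $\widetilde H$: create one copy (an occurrence copy) of each vertex for each of its hyperedge occurrences, and use those copies in the corresponding source hyperedges (so distinct source hyperedges become vertex-disjoint). For every original vertex, arrange its occurrence copies in a path, and for every consecutive pair $x,y$ on the path add a copy of $\mathcal Q(x,y;a,b,c)$ with fresh auxiliary vertices $a,b,c$. $\mathrm{NAE}_3=\{0,1\}^3\setminus\{000,111\}$. For an ordered $3$-uniform hypergraph $H$ (here $H$ or $\widetilde H$), the uniform $\mathrm{NAE}_3$ empirical model $e_H$ is: observables (outcomes in $\{0,1\}$) are one central observable for each non-isolated vertex, and for each hyperedge $e=(v_1,v_2,v_3)$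 and $j$ a fresh observable $v_j^e$. Contexts and tables: for each $e$, the context $(v_1^e,v_2^e,v_3^e)$ with the uniform distribution on $\mathrm{NAE}_3$ (mass $1/6$ on each of the six tuples, $0$ otherwise); for each $e,j$, the context $(v_j,v_j^e)$ with mass $1/2$ on $(0,0)$ and on $(1,1)$ and $0$ otherwise. For a finite empirical model $e$ with tables $e_C$, $\mathrm{NCF}(e)=\max\{\sum_g b_g:\ \sum_{g:\,g|_C=u}b_g\le e_C(u)\text{ for all contexts }C\text{ and local outcomes }u,\ b_g\ge0\}$, where $g$ ranges over all global assignments of outcomes to observables.
   Formalization: In the formal definition of NCF, the weights b_g range over the rationals instead of the reals (the tables are rational, so the maximum of this linear programme is the same). -}

module Defs where

open import Data.Bool.Base using (Bool; true; false; if_then_else_)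
open import Data.Empty using (⊥-elim)
open import Data.Fin.Base as Fin using (Fin; zero; suc; toℕ; _↑ˡ_; _↑ʳ_; combine; remQuot; splitAt; finToFun; funToFin)
open import Data.Fin.Patterns using (0F; 1F; 2F)
import Data.Fin.Properties as Fin
open import Data.List.Base as List using (List; []; _∷_)
open import Data.List.Relation.Binary.Permutation.Propositional using (_↭_)
open import Data.List.Relation.Unary.All as All using (All; []; _∷_)
import Data.List.Relation.Unary.All.Properties as All
open import Data.Nat.Base as ℕ using (ℕ; zero; suc)
import Data.Nat.Properties as ℕ
open import Data.Product.Base using (∃; _×_; _,_; proj₁; proj₂; uncurry)
import Data.Integer.Base as ℤ
open import Data.Rational.Base
open import Data.Rational.Properties as ℚ hiding (_≟_)
open import Data.Rational.Solver using (module +-*-Solver)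
open import Data.Sum.Base using (inj₁; inj₂; [_,_]′)
open import Data.Vec.Base as Vec using (Vec; []; _∷_)
import Data.Vec.Properties as Vec
import Data.Vec.Membership.Propositional.Properties as Vec
open import Data.Vec.Membership.Propositional as Vec using (_∈_)
open import Data.Vec.Relation.Unary.All using () renaming (All to VecAll)
open import Data.Vec.Relation.Unary.Any using (any?; here; there)
open import Data.Vec.Relation.Unary.Unique.Propositional using (Unique)
open import Function.Base using (_∘_; id)
open import Function.Bundles using (_⇔_)
open import Relation.Binary.Definitions using (tri<; tri≈; tri>)
open import Relation.Binary.PropositionalEquality
open import Relation.Nullary.Decidable using (Dec; does; yes; no; ¬?; _×-dec_; dec-true)
open import Relation.Nullary.Negation using (¬_)

open import Algebra.Properties.CommutativeMonoid.Sum +-0-commutativeMonoid using (sum; sum-cong-≗; sum-replicate-zero)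

-- An indexed family of triples, so a triple may be repeated; distinctness of
-- the vertices of a triple is the separate predicate ThreeUniform.
record Hypergraph : Set where
  field
    #V   : ℕ
    #E   : ℕ
    edge : Fin #E → Vec (Fin #V) 3

open Hypergraph public

ThreeUniform : Hypergraph → Set
ThreeUniform H = ∀ e → Unique (edge H e)

Simple : Hypergraph → Set
Simple H = ∀ e f → (∀ v → v ∈ edge H e ⇔ v ∈ edge H f) → e ≡ f

NoIsolated : Hypergraph → Set
NoIsolated H = ∀ v → ∃ λ e → v ∈ edge H e

degree : (H : Hypergraph) → Fin (#V H) → ℕ
degree H v = List.length (List.filter (λ e → any? (v Fin.≟_) (edge H e)) (List.allFin (#E H)))

Colouring : Hypergraph → Set
Colouring H = Fin (#V H) → Fin 2

Proper : (H : Hypergraph) → Colouring H → Set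
Proper H χ = ∀ e → ¬ ∃ λ c → VecAll (λ v → χ v ≡ c) (edge H e)

𝒬 : ∀ {A : Set} → A → A → A → A → A → Vec (Vec A 3) 6
𝒬 x y a b c =
  (x ∷ a ∷ b ∷ []) ∷ (x ∷ a ∷ c ∷ []) ∷ (x ∷ b ∷ c ∷ []) ∷
  (y ∷ a ∷ b ∷ []) ∷ (y ∷ a ∷ c ∷ []) ∷ (y ∷ b ∷ c ∷ []) ∷ []

-- (e , j) is the occurrence of a vertex at position j of the hyperedge e.
Occurrence : Hypergraph → Set
Occurrence H = Fin (#E H) × Fin 3

vertexAt : (H : Hypergraph) → Occurrence H → Fin (#V H)
vertexAt H (e , j) = Vec.lookup (edge H e) j

occurrences : (H : Hypergraph) → Fin (#V H) → List (Occurrence H)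
occurrences H v = List.filter (λ o → vertexAt H o Fin.≟ v)
  (List.cartesianProduct (List.allFin (#E H)) (List.allFin 3))

-- The order of the copies along each path is a free choice.
record Arrangement (H : Hypergraph) : Set where
  field
    path   : Fin (#V H) → List (Occurrence H)
    path-↭ : ∀ v → path v ↭ occurrences H v

consecutive : ∀ {A : Set} → List A → List (A × A)
consecutive xs = List.zip xs (List.drop 1 xs)

module Compilation (H : Hypergraph) (P : Arrangement H) where
  open Arrangement P

  links : List (Occurrence H × Occurrence H)
  links = List.concatMap (consecutive ∘ path) (List.allFin (#V H))

  #L : ℕ
  #L = List.length links

  -- The vertices are the occurrence copies followed by three auxiliary
  -- vertices for each link.
  Vertex : Set
  Vertex = Fin (#E H ℕ.* 3 ℕ.+ #L ℕ.* 3)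

  copy : Occurrence H → Vertex
  copy (e , j) = combine e j ↑ˡ (#L ℕ.* 3)

  aux : Fin #L → Fin 3 → Vertex
  aux l k = (#E H ℕ.* 3) ↑ʳ combine l k

  sourceEdge : Fin (#E H) → Vec Vertex 3
  sourceEdge e = Vec.tabulate λ j → copy (e , j)

  gadgetEdge : Fin #L → Fin 6 → Vec Vertex 3
  gadgetEdge l i = let (x , y) = List.lookup links l in
    Vec.lookup (𝒬 (copy x) (copy y) (aux l 0F) (aux l 1F) (aux l 2F)) i

  compiled : Hypergraph
  compiled = record
    { #V   = #E H ℕ.* 3 ℕ.+ #L ℕ.* 3
    ; #E   = #E H ℕ.+ #L ℕ.* 6
    ; edge = [ sourceEdge , uncurry gadgetEdge ∘ remQuot 6 ]′ ∘ splitAt (#E H)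
    }

open Compilation public using (compiled)

module _ (H : Hypergraph) (P : Arrangement H) where
  open Compilation H P using (#L; copy; aux; sourceEdge; gadgetEdge)

  edge-source : ∀ e → edge (compiled H P) (e ↑ˡ (#L ℕ.* 6)) ≡ sourceEdge e
  edge-source e =
    cong [ sourceEdge , uncurry gadgetEdge ∘ remQuot 6 ]′ (Fin.splitAt-↑ˡ (#E H) e (#L ℕ.* 6))

  edge-gadget : ∀ l i → edge (compiled H P) (#E H ↑ʳ combine l i) ≡ gadgetEdge l i
  edge-gadget l i = trans
    (cong [ sourceEdge , uncurry gadgetEdge ∘ remQuot 6 ]′ (Fin.splitAt-↑ʳ (#E H) (#L ℕ.* 6) (combine l i)))
    (cong (uncurry gadgetEdge) (Fin.remQuot-combine l i))

  compiled-noIsolated : NoIsolated (compiled H P)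
  compiled-noIsolated v with splitAt (#E H ℕ.* 3) v in eq
  ... | inj₁ i = subst Covered
      (trans (cong (_↑ˡ (#L ℕ.* 3)) (Fin.combine-remQuot {#E H} 3 i)) (Fin.splitAt⁻¹-↑ˡ eq))
      (copyCovered (remQuot 3 i))
    where
    Covered : Fin (#V (compiled H P)) → Set
    Covered w = ∃ λ e → w ∈ edge (compiled H P) e
    copyCovered : ∀ o → Covered (copy o)
    copyCovered (e , j) = e ↑ˡ (#L ℕ.* 6)
      , subst (copy (e , j) ∈_) (sym (edge-source e)) (Vec.∈-tabulate⁺ (λ k → copy (e , k)) j)
  ... | inj₂ i = subst Covered
      (trans (cong ((#E H ℕ.* 3) ↑ʳ_) (Fin.combine-remQuot {#L} 3 i)) (Fin.splitAt⁻¹-↑ʳ eq))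
      (uncurry auxCovered (remQuot 3 i))
    where
    Covered : Fin (#V (compiled H P)) → Set
    Covered w = ∃ λ e → w ∈ edge (compiled H P) e
    inGadget : ∀ {w} l i → w ∈ gadgetEdge l i → Covered w
    inGadget {w} l i p = #E H ↑ʳ combine l i , subst (w ∈_) (sym (edge-gadget l i)) p
    auxCovered : ∀ l k → Covered (aux l k)
    auxCovered l 0F = inGadget l 0F (there (here refl))
    auxCovered l 1F = inGadget l 0F (there (there (here refl)))
    auxCovered l 2F = inGadget l 1F (there (there (here refl)))

  compiled-nonZero : ℕ.NonZero (#E H) → ℕ.NonZero (#E (compiled H P))
  compiled-nonZero nz = ℕ.>-nonZero (ℕ.≤-trans (ℕ.>-nonZero⁻¹ (#E H) ⦃ nz ⦄) (ℕ.m≤m+n (#E H) (#L ℕ.* 6)))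

Outcomes : ℕ → Set
Outcomes k = Vec (Fin 2) k

-- finToFun enumerates the maps Fin k → Fin 2 by Fin (2 ^ k).
outcomes : ∀ {k} → Fin (2 ℕ.^ k) → Outcomes k
outcomes i = Vec.tabulate (finToFun i)

record Distribution (k : ℕ) : Set where
  field
    mass   : Outcomes k → ℚ
    mass≥0 : ∀ u → 0ℚ ≤ mass u
    total  : sum (λ i → mass (outcomes i)) ≡ 1ℚ

open Distribution public

record Context (k : ℕ) : Set where
  constructor _◂_
  field
    {arity} : ℕ
    scope   : Vec (Fin k) arity
    table   : Distribution arity

open Context public

-- At least one context is required: without any, the programme defining the
-- noncontextual fraction is unbounded.
record EmpiricalModel : Set where
  field
    #Obs     : ℕ
    contexts : List (Context #Obs)
    nonempty : contexts ≢ []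

open EmpiricalModel public

NAE₃ : Outcomes 3 → Set
NAE₃ u = u ≢ 0F ∷ 0F ∷ 0F ∷ [] × u ≢ 1F ∷ 1F ∷ 1F ∷ []

infix 4 _≟ᵒ_

_≟ᵒ_ : ∀ {k} (u w : Outcomes k) → Dec (u ≡ w)
_≟ᵒ_ = Vec.≡-dec Fin._≟_

NAE₃? : ∀ u → Dec (NAE₃ u)
NAE₃? u = ¬? (u ≟ᵒ _) ×-dec ¬? (u ≟ᵒ _)

uniformNAE : Distribution 3
uniformNAE = record
  { mass   = λ u → if does (NAE₃? u) then ℤ.+ 1 / 6 else 0ℚ
  ; mass≥0 = λ u → sixth≥0 (does (NAE₃? u))
  ; total  = refl
  }
  where
  sixth≥0 : ∀ c → 0ℚ ≤ (if c then ℤ.+ 1 / 6 else 0ℚ)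
  sixth≥0 true  = nonNegative⁻¹ (ℤ.+ 1 / 6)
  sixth≥0 false = ≤-refl

uniformEq : Distribution 2
uniformEq = record { mass = mass₂ ; mass≥0 = mass₂≥0 ; total = refl }
  where
  mass₂ : Outcomes 2 → ℚ
  mass₂ (0F ∷ 0F ∷ []) = ½
  mass₂ (1F ∷ 1F ∷ []) = ½
  mass₂ (0F ∷ 1F ∷ []) = 0ℚ
  mass₂ (1F ∷ 0F ∷ []) = 0ℚ
  mass₂≥0 : ∀ u → 0ℚ ≤ mass₂ u
  mass₂≥0 (0F ∷ 0F ∷ []) = nonNegative⁻¹ ½
  mass₂≥0 (1F ∷ 1F ∷ []) = nonNegative⁻¹ ½
  mass₂≥0 (0F ∷ 1F ∷ []) = ≤-refl
  mass₂≥0 (1F ∷ 0F ∷ []) = ≤-refl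

-- As no vertex is isolated, every vertex has a central observable.
module _ (H : Hypergraph) where
  central : Fin (#V H) → Fin (#V H ℕ.+ #E H ℕ.* 3)
  central v = v ↑ˡ (#E H ℕ.* 3)

  fresh : Occurrence H → Fin (#V H ℕ.+ #E H ℕ.* 3)
  fresh (e , j) = #V H ↑ʳ combine e j

  naeContexts : List (Context (#V H ℕ.+ #E H ℕ.* 3))
  naeContexts = List.concatMap
    (λ e → (Vec.tabulate (λ j → fresh (e , j)) ◂ uniformNAE)
         ∷ List.map (λ j → (central (vertexAt H (e , j)) ∷ fresh (e , j) ∷ []) ◂ uniformEq) (List.allFin 3))
    (List.allFin (#E H))

naeContexts≢[] : ∀ H → ℕ.NonZero (#E H) → naeContexts H ≢ []
naeContexts≢[] record { #E = suc _ } _ ()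

naeModel : (H : Hypergraph) → NoIsolated H → ℕ.NonZero (#E H) → EmpiricalModel
naeModel H _ nz = record
  { #Obs     = #V H ℕ.+ #E H ℕ.* 3
  ; contexts = naeContexts H
  ; nonempty = naeContexts≢[] H nz
  }

module _ (M : EmpiricalModel) where
  -- Global assignments, enumerated through finToFun.
  Global : Set
  Global = Fin (2 ℕ.^ #Obs M)

  restrict : Global → (C : Context (#Obs M)) → Outcomes (arity C)
  restrict g C = Vec.map (finToFun g) (scope C)

  marginal : (Global → ℚ) → (C : Context (#Obs M)) → Outcomes (arity C) → ℚ
  marginal b C u = sum λ g → if does (restrict g C ≟ᵒ u) then b g else 0ℚ

  Feasible : (Global → ℚ) → Set
  Feasible b = (∀ g → 0ℚ ≤ b g) × All (λ C → ∀ u → marginal b C u ≤ mass (table C) u) (contexts M)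

  IsNCF : ℚ → Set
  IsNCF q = (∃ λ b → Feasible b × sum b ≡ q) × (∀ b → Feasible b → sum b ≤ q)

module LinearProgramming where
  open +-*-Solver using (solve; _:=_; _:+_; _:*_; _:-_; :-_)

  -- Affine forms  a₁x₁ + … + aₙxₙ + k , as  a₁ , … , aₙ , k.
  Affine : ℕ → Set
  Affine zero    = ℚ
  Affine (suc n) = ℚ × Affine n

  ⟦_⟧ : ∀ {n} → Affine n → Vec ℚ n → ℚ
  ⟦ k ⟧     []       = k
  ⟦ a , f ⟧ (x ∷ xs) = a * x + ⟦ f ⟧ xs

  Sat : ∀ {n} → List (Affine n) → Vec ℚ n → Set
  Sat S xs = All (λ f → 0ℚ ≤ ⟦ f ⟧ xs) S

  _·_ : ∀ {n} → ℚ → Affine n → Affine n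
  _·_ {zero}  c k       = c * k
  _·_ {suc n} c (a , f) = c * a , c · f

  _⊖_ : ∀ {n} → Affine n → Affine n → Affine n
  _⊖_ {zero}  k l             = k - l
  _⊖_ {suc n} (a , f) (b , g) = a - b , f ⊖ g

  ⟦·⟧ : ∀ {n} c (f : Affine n) xs → ⟦ c · f ⟧ xs ≡ c * ⟦ f ⟧ xs
  ⟦·⟧ c k       []       = refl
  ⟦·⟧ c (a , f) (x ∷ xs) rewrite ⟦·⟧ c f xs =
    solve 4 (λ c a x y → c :* a :* x :+ c :* y := c :* (a :* x :+ y)) refl c a x (⟦ f ⟧ xs)

  ⟦⊖⟧ : ∀ {n} (f g : Affine n) xs → ⟦ f ⊖ g ⟧ xs ≡ ⟦ f ⟧ xs - ⟦ g ⟧ xs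
  ⟦⊖⟧ k l             []       = refl
  ⟦⊖⟧ (a , f) (b , g) (x ∷ xs) rewrite ⟦⊖⟧ f g xs =
    solve 5 (λ a b x y z → (a :- b) :* x :+ (y :- z) := (a :* x :+ y) :- (b :* x :+ z))
      refl a b x (⟦ f ⟧ xs) (⟦ g ⟧ xs)

  p≤q⇒0≤q-p : ∀ {p q} → p ≤ q → 0ℚ ≤ q - p
  p≤q⇒0≤q-p {p} {q} p≤q = subst (_≤ q - p) (+-inverseʳ p) (+-monoˡ-≤ (- p) p≤q)

  0≤q-p⇒p≤q : ∀ {p q} → 0ℚ ≤ q - p → p ≤ q
  0≤q-p⇒p≤q {p} {q} 0≤ = subst₂ _≤_ (+-identityˡ p)
    (solve 2 (λ p q → (q :- p) :+ p := q) refl p q) (+-monoˡ-≤ p 0≤)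

  divide : ∀ {n} a .⦃ _ : NonZero a ⦄ (f : Affine n) x ys →
           a * x + ⟦ f ⟧ ys ≡ a * x - a * ⟦ (- (1/ a)) · f ⟧ ys
  divide a f x ys rewrite ⟦·⟧ (- (1/ a)) f ys = begin
    a * x + y
      ≡⟨ cong (a * x +_) (sym (*-identityˡ y)) ⟩
    a * x + 1ℚ * y
      ≡⟨ cong (λ o → a * x + o * y) (sym (*-inverseʳ a)) ⟩
    a * x + a * c * y
      ≡⟨ solve 4 (λ a x c y → a :* x :+ a :* c :* y := a :* x :- a :* (:- c :* y)) refl a x c y ⟩
    a * x - a * (- c * y) ∎
    where
    open ≡-Reasoning
    c = 1/ a
    y = ⟦ f ⟧ ys

  -- A system in x, y splits into lower bounds l(y) ≤ x, upper bounds x ≤ u(y)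
  -- and constraints on y alone.
  record Split {n} (S : List (Affine (suc n))) : Set where
    field
      lower upper rest : List (Affine n)
      to   : ∀ x ys → Sat S (x ∷ ys) →
             All (λ l → ⟦ l ⟧ ys ≤ x) lower × All (λ u → x ≤ ⟦ u ⟧ ys) upper × Sat rest ys
      from : ∀ x ys →
             All (λ l → ⟦ l ⟧ ys ≤ x) lower → All (λ u → x ≤ ⟦ u ⟧ ys) upper → Sat rest ys →
             Sat S (x ∷ ys)

  split : ∀ {n} (S : List (Affine (suc n))) → Split S
  split [] = record
    { lower = [] ; upper = [] ; rest = []
    ; to = λ _ _ _ → [] , [] , [] ; from = λ _ _ _ _ _ → [] }
  split ((a , f) ∷ S) with split S | <-cmp 0ℚ a
  ... | s | tri< 0<a _ _ = record
    { lower = (- (1/ a)) · f ∷ lower ; upper = upper ; rest = rest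
    ; to    = λ where x ys (p ∷ ps) → let (q , r , t) = to x ys ps in fwd x ys p ∷ q , r , t
    ; from  = λ where x ys (p ∷ ps) q r → bwd x ys p ∷ from x ys ps q r }
    where
    open Split s
    instance
      a+ : Positive a
      a+ = positive 0<a
      a≠0 : NonZero a
      a≠0 = pos⇒nonZero a
    key : ∀ x ys → a * x + ⟦ f ⟧ ys ≡ a * x - a * ⟦ (- (1/ a)) · f ⟧ ys
    key = divide a f
    fwd : ∀ x ys → 0ℚ ≤ a * x + ⟦ f ⟧ ys → ⟦ (- (1/ a)) · f ⟧ ys ≤ x
    fwd x ys p = *-cancelˡ-≤-pos a (0≤q-p⇒p≤q (subst (0ℚ ≤_) (key x ys) p))
    bwd : ∀ x ys → ⟦ (- (1/ a)) · f ⟧ ys ≤ x → 0ℚ ≤ a * x + ⟦ f ⟧ ys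
    bwd x ys p = subst (0ℚ ≤_) (sym (key x ys))
      (p≤q⇒0≤q-p (*-monoˡ-≤-nonNeg a ⦃ pos⇒nonNeg a ⦄ p))
  ... | s | tri≈ _ 0≡a _ = record
    { lower = lower ; upper = upper ; rest = f ∷ rest
    ; to    = λ where x ys (p ∷ ps) → let (q , r , t) = to x ys ps in q , r , subst (0ℚ ≤_) (key x ys) p ∷ t
    ; from  = λ where x ys q r (p ∷ ps) → subst (0ℚ ≤_) (sym (key x ys)) p ∷ from x ys q r ps }
    where
    open Split s
    key : ∀ x ys → a * x + ⟦ f ⟧ ys ≡ ⟦ f ⟧ ys
    key x ys rewrite sym 0≡a | *-zeroˡ x = +-identityˡ _
  ... | s | tri> _ _ a<0 = record
    { lower = lower ; upper = (- (1/ a)) · f ∷ upper ; rest = rest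
    ; to    = λ where x ys (p ∷ ps) → let (q , r , t) = to x ys ps in q , fwd x ys p ∷ r , t
    ; from  = λ where x ys q (p ∷ ps) r → bwd x ys p ∷ from x ys q ps r }
    where
    open Split s
    instance
      a- : Negative a
      a- = negative a<0
      a≠0 : NonZero a
      a≠0 = neg⇒nonZero a
    key : ∀ x ys → a * x + ⟦ f ⟧ ys ≡ a * x - a * ⟦ (- (1/ a)) · f ⟧ ys
    key = divide a f
    fwd : ∀ x ys → 0ℚ ≤ a * x + ⟦ f ⟧ ys → x ≤ ⟦ (- (1/ a)) · f ⟧ ys
    fwd x ys p = *-cancelˡ-≤-neg a (0≤q-p⇒p≤q (subst (0ℚ ≤_) (key x ys) p))
    bwd : ∀ x ys → x ≤ ⟦ (- (1/ a)) · f ⟧ ys → 0ℚ ≤ a * x + ⟦ f ⟧ ys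
    bwd x ys p = subst (0ℚ ≤_) (sym (key x ys))
      (p≤q⇒0≤q-p (*-monoˡ-≤-nonPos a ⦃ neg⇒nonPos a ⦄ p))

  between : (ls us : List ℚ) → All (λ l → All (l ≤_) us) ls →
            ∃ λ x → All (_≤ x) ls × All (x ≤_) us
  between [] [] _ = 0ℚ , [] , []
  between [] (u ∷ us) _ with between [] us []
  ... | x , _ , x≤us = u ⊓ x , [] , p⊓q≤p u x ∷ All.map (≤-trans (p⊓q≤q u x)) x≤us
  between (l ∷ ls) us (l≤us ∷ h) with between ls us h
  ... | x , ls≤x , x≤us = l ⊔ x
    , p≤p⊔q l x ∷ All.map (λ p → ≤-trans p (p≤q⊔p l x)) ls≤x
    , All.zipWith (λ (p , q) → ⊔-lub p q) (l≤us , x≤us)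

  -- Fourier–Motzkin elimination of the first variable.
  record Projection {n} (S : List (Affine (suc n))) : Set where
    field
      system   : List (Affine n)
      sound    : ∀ x ys → Sat S (x ∷ ys) → Sat system ys
      complete : ∀ ys → Sat system ys → ∃ λ x → Sat S (x ∷ ys)

  project : ∀ {n} (S : List (Affine (suc n))) → Projection S
  project S = record
    { system   = List.cartesianProductWith (λ l u → u ⊖ l) lower upper List.++ rest
    ; sound    = λ x ys h → let (ls , us , r) = to x ys h in
        All.++⁺ (pairs ys (All.map (λ p → All.map (≤-trans p) us) ls)) r
    ; complete = λ ys h →
        let (x , p , q) = between (List.map (λ l → ⟦ l ⟧ ys) lower) (List.map (λ u → ⟦ u ⟧ ys) upper)
                            (All.map⁺ (All.map All.map⁺ (unpairs lower ys (All.++⁻ˡ _ h))))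
        in x , from x ys (All.map⁻ p) (All.map⁻ q) (All.++⁻ʳ (List.cartesianProductWith (λ l u → u ⊖ l) lower upper) h)
    }
    where
    open Split (split S)
    pairs : ∀ {ls} ys → All (λ l → All (λ u → ⟦ l ⟧ ys ≤ ⟦ u ⟧ ys) upper) ls →
            Sat (List.cartesianProductWith (λ l u → u ⊖ l) ls upper) ys
    pairs ys [] = []
    pairs {l ∷ _} ys (p ∷ ps) = All.++⁺
      (All.map⁺ (All.map (λ {u} q → subst (0ℚ ≤_) (sym (⟦⊖⟧ u l ys)) (p≤q⇒0≤q-p q)) p)) (pairs ys ps)
    unpairs : ∀ ls ys → Sat (List.cartesianProductWith (λ l u → u ⊖ l) ls upper) ys →
              All (λ l → All (λ u → ⟦ l ⟧ ys ≤ ⟦ u ⟧ ys) upper) ls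
    unpairs [] _ _ = []
    unpairs (l ∷ ls) ys h =
      All.map (λ {u} q → 0≤q-p⇒p≤q (subst (0ℚ ≤_) (⟦⊖⟧ u l ys) q)) (All.map⁻ (All.++⁻ˡ _ h))
      ∷ unpairs ls ys (All.++⁻ʳ (List.map (λ u → u ⊖ l) upper) h)

  projectAll : ∀ n (S : List (Affine (n ℕ.+ 1))) →
    ∃ λ (T : List (Affine 1)) → ∀ t →
      (∀ (xs : Vec ℚ n) → Sat S (xs Vec.++ t ∷ []) → Sat T (t ∷ [])) ×
      (Sat T (t ∷ []) → ∃ λ (xs : Vec ℚ n) → Sat S (xs Vec.++ t ∷ []))
  projectAll zero    S = S , λ t → (λ { [] h → h }) , λ h → [] , h
  projectAll (suc n) S with projectAll n (Projection.system (project S))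
  ... | T , TS = T , λ t →
      (λ { (x ∷ xs) h → proj₁ (TS t) xs (sound x (xs Vec.++ t ∷ []) h) })
    , (λ h → let (xs , k) = proj₂ (TS t) h ; (x , j) = complete (xs Vec.++ t ∷ []) k in x ∷ xs , j)
    where open Projection (project S)

  maximum₁ : (T : List (Affine 1)) (t₀ M : ℚ) → Sat T (t₀ ∷ []) → (∀ {t} → Sat T (t ∷ []) → t ≤ M) →
             ∃ λ t → Sat T (t ∷ []) × (∀ {t′} → Sat T (t′ ∷ []) → t′ ≤ t)
  maximum₁ T t₀ M sat bound = go upper refl
    where
    open Split (split T)
    lift : ∀ {t} → t₀ ≤ t → All (λ u → t ≤ ⟦ u ⟧ []) upper → Sat T (t ∷ [])
    lift le us = from _ [] (All.map (λ p → ≤-trans p le) (proj₁ (to _ [] sat))) us (proj₂ (proj₂ (to _ [] sat)))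
    min : (u : ℚ) (us : List ℚ) → ∃ λ m → All (m ≤_) (u ∷ us) × (∀ {t} → All (t ≤_) (u ∷ us) → t ≤ m)
    min u []        = u , ≤-refl ∷ [] , λ { (p ∷ []) → p }
    min u (u′ ∷ us) with min u′ us
    ... | m , m≤ , glb = u ⊓ m , p⊓q≤p u m ∷ All.map (≤-trans (p⊓q≤q u m)) m≤
                       , λ { (p ∷ ps) → ⊓-glb p (glb ps) }
    go : (us : List ℚ) → us ≡ upper → ∃ λ t → Sat T (t ∷ []) × (∀ {t′} → Sat T (t′ ∷ []) → t′ ≤ t)
    go [] eq = ⊥-elim (<-irrefl refl (<-≤-trans M<M+1 (≤-trans (p≤q⊔p t₀ (M + 1ℚ)) (bound unbounded))))
      where
      M<M+1 : M < M + 1ℚ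
      M<M+1 = subst (_< M + 1ℚ) (+-identityʳ M) (+-monoʳ-< M (positive⁻¹ 1ℚ))
      unbounded : Sat T ((t₀ ⊔ (M + 1ℚ)) ∷ [])
      unbounded = lift (p≤p⊔q t₀ (M + 1ℚ)) (subst (All _) eq [])
    go (u ∷ us) eq with min u us
    ... | m , m≤ , glb = m
      , lift (glb (subst (All (t₀ ≤_)) (sym eq) (proj₁ (proj₂ (to _ [] sat))))) (subst (All (m ≤_)) eq m≤)
      , λ {t} h → glb (subst (All (t ≤_)) (sym eq) (proj₁ (proj₂ (to _ [] h))))

  linear : ∀ {n} → (Fin n → ℚ) → ℚ → ℚ → Affine (n ℕ.+ 1)
  linear {zero}  a β k = β , k
  linear {suc n} a β k = a zero , linear (a ∘ suc) β k

  ⟦linear⟧ : ∀ {n} a β k (xs : Vec ℚ n) t →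
    ⟦ linear a β k ⟧ (xs Vec.++ t ∷ []) ≡ sum (λ i → a i * Vec.lookup xs i) + (β * t + k)
  ⟦linear⟧ a β k []       t = sym (+-identityˡ _)
  ⟦linear⟧ a β k (x ∷ xs) t rewrite ⟦linear⟧ (a ∘ suc) β k xs t =
    sym (+-assoc (a zero * x) (sum (λ i → a (suc i) * Vec.lookup xs i)) (β * t + k))

  -- A linear programme over ℚ that is feasible and bounded attains its maximum.
  Satisfies : ∀ {n} → List ((Fin n → ℚ) × ℚ) → (Fin n → ℚ) → Set
  Satisfies S b = All (λ (a , k) → 0ℚ ≤ sum (λ i → a i * b i) + k) S

  maximum : ∀ {n} (S : List ((Fin n → ℚ) × ℚ)) {b₀ M} →
    Satisfies S b₀ → (∀ {b} → Satisfies S b → sum b ≤ M) →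
    ∃ λ b → Satisfies S b × (∀ {b′} → Satisfies S b′ → sum b′ ≤ sum b)
  maximum {n} S {b₀} {M} sat₀ bound =
    let (T , TS)           = projectAll n S⁺
        (t , sat , upper)  = maximum₁ T (sum b₀) M (proj₁ (TS _) (Vec.tabulate b₀) (to b₀ _ sat₀ ≤-refl))
                               (λ h → let (xs , h′) = proj₂ (TS _) h ; (s , le) = from xs h′
                                      in ≤-trans le (bound s))
        (xs , satxs)       = proj₂ (TS _) sat
        (s , le)           = from xs satxs
    in Vec.lookup xs , s , λ {b} h → ≤-trans (upper (proj₁ (TS _) (Vec.tabulate b) (to b _ h ≤-refl))) le
    where
    objective : Affine (n ℕ.+ 1)
    objective = linear (λ _ → 1ℚ) (- 1ℚ) 0ℚ
    S⁺ : List (Affine (n ℕ.+ 1))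
    S⁺ = objective ∷ List.map (λ (a , k) → linear a 0ℚ k) S
    constraint : ∀ a k (xs : Vec ℚ n) t → ⟦ linear a 0ℚ k ⟧ (xs Vec.++ t ∷ []) ≡ sum (λ i → a i * Vec.lookup xs i) + k
    constraint a k xs t = trans (⟦linear⟧ a 0ℚ k xs t)
      (cong (sum (λ i → a i * Vec.lookup xs i) +_) (trans (cong (_+ k) (*-zeroˡ t)) (+-identityˡ k)))
    goal : ∀ (xs : Vec ℚ n) t → ⟦ objective ⟧ (xs Vec.++ t ∷ []) ≡ sum (Vec.lookup xs) - t
    goal xs t = trans (⟦linear⟧ (λ _ → 1ℚ) (- 1ℚ) 0ℚ xs t)
      (cong₂ _+_ (sum-cong-≗ (λ i → *-identityˡ (Vec.lookup xs i)))
        (trans (+-identityʳ (- 1ℚ * t)) (trans (sym (neg-distribˡ-* 1ℚ t)) (cong -_ (*-identityˡ t)))))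
    to : ∀ b t → Satisfies S b → t ≤ sum b → Sat S⁺ (Vec.tabulate b Vec.++ t ∷ [])
    to b t h le =
        subst (0ℚ ≤_) (sym (goal (Vec.tabulate b) t))
          (p≤q⇒0≤q-p (subst (t ≤_) (sum-cong-≗ (λ i → sym (Vec.lookup∘tabulate b i))) le))
      ∷ All.map⁺ (All.map (λ {(a , k)} p → subst (0ℚ ≤_)
          (trans (cong (_+ k) (sum-cong-≗ (λ i → cong (a i *_) (sym (Vec.lookup∘tabulate b i)))))
            (sym (constraint a k (Vec.tabulate b) t))) p) h)
    from : ∀ {t} (xs : Vec ℚ n) → Sat S⁺ (xs Vec.++ t ∷ []) → Satisfies S (Vec.lookup xs) × t ≤ sum (Vec.lookup xs)
    from {t} xs (p ∷ ps) =
        All.map (λ {(a , k)} q → subst (0ℚ ≤_) (constraint a k xs t) q) (All.map⁻ ps)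
      , 0≤q-p⇒p≤q (subst (0ℚ ≤_) (goal xs t) p)

open LinearProgramming using (Satisfies; maximum)

module _ where
  sum-mono-≤ : ∀ {n} {f g : Fin n → ℚ} → (∀ i → f i ≤ g i) → sum f ≤ sum g
  sum-mono-≤ {zero}  h = ≤-refl
  sum-mono-≤ {suc n} h = +-mono-≤ (h zero) (sum-mono-≤ (h ∘ suc))

  sum-nonNeg : ∀ {n} {f : Fin n → ℚ} → (∀ i → 0ℚ ≤ f i) → 0ℚ ≤ sum f
  sum-nonNeg {zero}  h = ≤-refl
  sum-nonNeg {suc n} h = +-mono-≤ (h zero) (sum-nonNeg (h ∘ suc))

  term≤sum : ∀ {n} {f : Fin n → ℚ} → (∀ i → 0ℚ ≤ f i) → ∀ i → f i ≤ sum f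
  term≤sum {suc n} {f} h zero = subst (_≤ f zero + sum (f ∘ suc)) (+-identityʳ (f zero))
    (+-monoʳ-≤ (f zero) (sum-nonNeg (h ∘ suc)))
  term≤sum {suc n} {f} h (suc i) = subst (_≤ f zero + sum (f ∘ suc)) (+-identityˡ (f (suc i)))
    (+-mono-≤ (h zero) (term≤sum (h ∘ suc) i))

  sum-zero : ∀ {n} {f : Fin n → ℚ} → (∀ i → f i ≡ 0ℚ) → sum f ≡ 0ℚ
  sum-zero {n} h = trans (sum-cong-≗ h) (sum-replicate-zero n)

  unit : ∀ {n} → Fin n → Fin n → ℚ
  unit zero    zero    = 1ℚ
  unit zero    (suc j) = 0ℚ
  unit (suc i) zero    = 0ℚ
  unit (suc i) (suc j) = unit i j

  sum-unit : ∀ {n} (i : Fin n) (b : Fin n → ℚ) → sum (λ j → unit i j * b j) ≡ b i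
  sum-unit zero    b = trans (cong₂ _+_ (*-identityˡ (b zero)) (sum-zero λ j → *-zeroˡ (b (suc j)))) (+-identityʳ (b zero))
  sum-unit (suc i) b = trans (cong₂ _+_ (*-zeroˡ (b zero)) (sum-unit i (b ∘ suc))) (+-identityˡ (b (suc i)))

  sum-select : ∀ {n} (p : Fin n → Bool) (b : Fin n → ℚ) →
    sum (λ j → (if p j then - 1ℚ else 0ℚ) * b j) ≡ - sum (λ j → if p j then b j else 0ℚ)
  sum-select {zero}  p b = refl
  sum-select {suc n} p b = trans (cong₂ _+_ (head (p zero)) (sum-select (p ∘ suc) (b ∘ suc)))
    (sym (neg-distrib-+ (if p zero then b zero else 0ℚ) (sum (λ j → if p (suc j) then b (suc j) else 0ℚ))))
    where
    head : ∀ c → (if c then - 1ℚ else 0ℚ) * b zero ≡ - (if c then b zero else 0ℚ)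
    head true  = trans (sym (neg-distribˡ-* 1ℚ (b zero))) (cong -_ (*-identityˡ (b zero)))
    head false = *-zeroˡ (b zero)

outcomes-surjective : ∀ {k} (u : Outcomes k) → outcomes (funToFin (Vec.lookup u)) ≡ u
outcomes-surjective u = trans (Vec.tabulate-cong (Fin.finToFun-funToFin (Vec.lookup u))) (Vec.tabulate∘lookup u)

module _ (M : EmpiricalModel) where
  private
    N = 2 ℕ.^ #Obs M

    nonNegRow : Global M → (Global M → ℚ) × ℚ
    nonNegRow g = unit g , 0ℚ

    tableRow : (C : Context (#Obs M)) → Outcomes (arity C) → (Global M → ℚ) × ℚ
    tableRow C u = (λ g → if does (restrict M g C ≟ᵒ u) then - 1ℚ else 0ℚ) , mass (table C) u

    tableRows : Context (#Obs M) → List ((Global M → ℚ) × ℚ)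
    tableRows C = List.tabulate (tableRow C ∘ outcomes)

    rows : List ((Global M → ℚ) × ℚ)
    rows = List.tabulate nonNegRow List.++ List.concatMap tableRows (contexts M)

    Row : (Global M → ℚ) → (Global M → ℚ) × ℚ → Set
    Row b (a , k) = 0ℚ ≤ sum {N} (λ i → a i * b i) + k

    nonNegRow≡ : ∀ b (g : Global M) → sum {N} (λ i → unit g i * b i) + 0ℚ ≡ b g
    nonNegRow≡ b g = trans (+-identityʳ _) (sum-unit g b)

    tableRow≡ : ∀ b C u → sum (λ g → proj₁ (tableRow C u) g * b g) + mass (table C) u
                        ≡ mass (table C) u - marginal M b C u
    tableRow≡ b C u = trans (cong (_+ mass (table C) u) (sum-select (λ g → does (restrict M g C ≟ᵒ u)) b))
      (+-comm (- marginal M b C u) (mass (table C) u))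

    feasible⇒satisfies : ∀ {b} → Feasible M b → Satisfies rows b
    feasible⇒satisfies {b} (b≥0 , h) = All.++⁺
      (All.tabulate⁺ (λ g → subst (0ℚ ≤_) (sym (nonNegRow≡ b g)) (b≥0 g)))
      (All.concat⁺ (All.map⁺ (All.map
        (λ {C} p → All.tabulate⁺ λ i →
          subst (0ℚ ≤_) (sym (tableRow≡ b C (outcomes i))) (LinearProgramming.p≤q⇒0≤q-p (p (outcomes i))))
        h)))

    satisfies⇒feasible : ∀ {b} → Satisfies rows b → Feasible M b
    satisfies⇒feasible {b} h =
        (λ g → subst (0ℚ ≤_) (nonNegRow≡ b g) (All.tabulate⁻ {P = Row b} {f = nonNegRow} (All.++⁻ˡ (List.tabulate nonNegRow) h) g))
      , All.map (λ {C} p u → subst (λ w → marginal M b C w ≤ mass (table C) w) (outcomes-surjective u)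
          (LinearProgramming.0≤q-p⇒p≤q (subst (0ℚ ≤_) (tableRow≡ b C _)
            (All.tabulate⁻ {P = Row b} {f = tableRow C ∘ outcomes} p (funToFin (Vec.lookup u))))))
          (All.map⁻ (All.concat⁻ (All.++⁻ʳ (List.tabulate nonNegRow) h)))

    zero-feasible : Feasible M (λ _ → 0ℚ)
    zero-feasible = (λ _ → ≤-refl) , All.universal
      (λ C u → subst (_≤ mass (table C) u) (sym (sum-zero (λ g → if-eta (does (restrict M g C ≟ᵒ u)))))
        (mass≥0 (table C) u)) (contexts M)
      where
      if-eta : ∀ c → (if c then 0ℚ else 0ℚ) ≡ 0ℚ
      if-eta true  = refl
      if-eta false = refl

    bounded : ∃ λ q → ∀ {b} → Feasible M b → sum b ≤ q
    bounded with contexts M | nonempty M | (λ {b} (h : Feasible M b) → h)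
    ... | []    | ne | _ = ⊥-elim (ne refl)
    ... | C ∷ _ | _  | unpack = sum (λ g → mass (table C) (restrict M g C)) , λ {b} h → bound b (unpack h)
      where
      bound : ∀ b {Cs} → (∀ g → 0ℚ ≤ b g) × All (λ C → ∀ u → marginal M b C u ≤ mass (table C) u) (C ∷ Cs) →
              sum b ≤ sum (λ g → mass (table C) (restrict M g C))
      bound b (b≥0 , p ∷ _) = sum-mono-≤ λ g → ≤-trans (single g) (p (restrict M g C))
        where
        keep : ∀ c g → 0ℚ ≤ (if c then b g else 0ℚ)
        keep true  g = b≥0 g
        keep false g = ≤-refl
        single : ∀ g → b g ≤ marginal M b C (restrict M g C)
        single g = subst (_≤ marginal M b C (restrict M g C))
          (cong (if_then b g else 0ℚ) (dec-true (restrict M g C ≟ᵒ restrict M g C) refl))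
          (term≤sum (λ h → keep (does (restrict M h C ≟ᵒ restrict M g C)) h) g)

  NCF-exists : ∃ (IsNCF M)
  NCF-exists =
    let (_ , bound)     = bounded
        (b , sat , max) = maximum rows (feasible⇒satisfies zero-feasible) (bound ∘ satisfies⇒feasible)
    in sum b , (b , satisfies⇒feasible sat , refl) , λ _ h → max (feasible⇒satisfies h)

-- The optimum of a linear programme with rational data is the same over ℚ and ℝ.
abstract
  NCF : EmpiricalModel → ℚ
  NCF M = proj₁ (NCF-exists M)

  NCF-isNCF : ∀ M → IsNCF M (NCF M)
  NCF-isNCF M = proj₂ (NCF-exists M)

infix  4 _⊢_⇓_▷_
infixr 5 _⨾_
infix  6 _≔_ _[_]≔_

-- A random access machine, as a structured program over registers and arrays
-- of naturals, all indexed by naturals.  Each instruction and each test costs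
-- one step.  Arithmetic is limited to ±1, so every value is at most the
-- largest initial value or constant of the program plus the number of steps,
-- and the unit cost hides no large words.

data Rhs : Set where
  const     : ℕ → Rhs
  reg       : ℕ → Rhs
  inc dec   : ℕ → Rhs
  _[_]      : (array index : ℕ) → Rhs

data Program : Set where
  skip    : Program
  _≔_     : ℕ → Rhs → Program
  _[_]≔_  : (array index source : ℕ) → Program
  _⨾_     : Program → Program → Program
  ifnz    : ℕ → Program → Program → Program
  while   : ℕ → Program → Program

record State : Set where
  constructor ⟨_,_⟩
  field
    regs : ℕ → ℕ
    arrs : ℕ → ℕ → ℕ

open State public

_[_↦_] : ∀ {A : Set} → (ℕ → A) → ℕ → A → ℕ → A
(f [ i ↦ x ]) j = if j ℕ.≡ᵇ i then x else f j

eval : Rhs → State → ℕ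
eval (const k) s = k
eval (reg x)   s = regs s x
eval (inc x)   s = suc (regs s x)
eval (dec x)   s = ℕ.pred (regs s x)
eval (a [ x ]) s = arrs s a (regs s x)

assign : ℕ → Rhs → State → State
assign x r s = record s { regs = regs s [ x ↦ eval r s ] }

-- store a x y s writes register y to the cell of array a indexed by register x.
store : ℕ → ℕ → ℕ → State → State
store a x y s = record s { arrs = arrs s [ a ↦ arrs s a [ regs s x ↦ regs s y ] ] }

-- s ⊢ p ⇓ s′ ▷ t : program p run from s halts in s′ after t steps.
data _⊢_⇓_▷_ : State → Program → State → ℕ → Set where
  run-skip   : ∀ {s} → s ⊢ skip ⇓ s ▷ 1
  run-assign : ∀ {s x r} → s ⊢ x ≔ r ⇓ assign x r s ▷ 1
  run-store  : ∀ {s a x y} → s ⊢ a [ x ]≔ y ⇓ store a x y s ▷ 1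
  run-seq    : ∀ {s s′ s″ p q t u} → s ⊢ p ⇓ s′ ▷ t → s′ ⊢ q ⇓ s″ ▷ u → s ⊢ p ⨾ q ⇓ s″ ▷ (t ℕ.+ u)
  run-then   : ∀ {s s′ x p q t} → regs s x ≢ 0 → s ⊢ p ⇓ s′ ▷ t → s ⊢ ifnz x p q ⇓ s′ ▷ suc t
  run-else   : ∀ {s s′ x p q t} → regs s x ≡ 0 → s ⊢ q ⇓ s′ ▷ t → s ⊢ ifnz x p q ⇓ s′ ▷ suc t
  run-loop   : ∀ {s s′ s″ x p t u} → regs s x ≢ 0 → s ⊢ p ⇓ s′ ▷ t → s′ ⊢ while x p ⇓ s″ ▷ u →
               s ⊢ while x p ⇓ s″ ▷ suc (t ℕ.+ u)
  run-exit   : ∀ {s x p} → regs s x ≡ 0 → s ⊢ while x p ⇓ s ▷ 1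

cells : ∀ {n} → (Fin n → ℕ) → ℕ → ℕ
cells {zero}  f i       = 0
cells {suc n} f zero    = f zero
cells {suc n} f (suc i) = cells (f ∘ suc) i

-- Registers 0 and 1 hold the numbers of vertices and of hyperedges, array 0
-- the colouring and array 1 the concatenated hyperedges; all else is 0.
input : (H : Hypergraph) → Colouring H → State
input H χ = ⟨ regs₀ , arrs₀ ⟩
  where
  regs₀ : ℕ → ℕ
  regs₀ 0 = #V H
  regs₀ 1 = #E H
  regs₀ _ = 0
  arrs₀ : ℕ → ℕ → ℕ
  arrs₀ 0 = cells (toℕ ∘ χ)
  arrs₀ 1 = cells (toℕ ∘ vertexAt H ∘ remQuot {#E H} 3)
  arrs₀ _ = λ _ → 0

inputSize : Hypergraph → ℕ
inputSize H = 2 ℕ.+ #V H ℕ.+ #E H ℕ.* 3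

-- Array 2 holds the colouring.
Outputs : (H : Hypergraph) → State → Colouring H → Set
Outputs H s χ = ∀ v → arrs s 2 (toℕ v) ≡ toℕ (χ v)

{-# OPTIONS --safe #-}

-- A feasible b for the model of a hypergraph is supported on proper colourings,
-- as it vanishes wherever a table does; the only remaining constraints are the
-- bounds 1/6 on the hyperedges, which imply the bounds 1/2 on single vertices.
-- So the noncontextual fraction is the largest weight of a mixture of proper
-- colourings with these bounds.  In a proper colouring of the gadget two of
-- a, b, c share a colour, which x and y must then avoid; hence x and y agree and
-- mixtures descend from the compilation.  Conversely, a colouring is lifted by
-- giving exactly one of a, b, c the colour of x and y; the average of the three
-- choices keeps the mass of every tuple on a gadget hyperedge at most 1/6.
module Submission where

open import Defs
open import Data.Bool.Base using (Bool; true; false; if_then_else_)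
open import Data.Fin.Base using (Fin; zero; suc; toℕ; _↑ˡ_; _↑ʳ_; combine; remQuot; splitAt; finToFun; funToFin; opposite)
open import Data.Fin.Patterns using (0F; 1F; 2F; 3F; 4F; 5F)
import Data.Fin.Properties as Fin
import Data.Integer.Base as ℤ
open import Data.List.Base as List using (List; []; _∷_; _∷ʳ_; _++_)
import Data.List.Membership.Propositional as List
import Data.List.Membership.Propositional.Properties as List
import Data.List.Properties as List
open import Data.List.Relation.Binary.Permutation.Propositional using (↭-sym; ↭⇒↭ₛ)
import Data.List.Relation.Binary.Permutation.Propositional.Properties as ↭
import Data.List.Relation.Binary.Permutation.Setoid.Properties as ↭ₛ
open import Data.List.Relation.Unary.All as All using (All; []; _∷_)
import Data.List.Relation.Unary.All.Properties as All
import Data.List.Relation.Unary.AllPairs as AllPairs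
import Data.List.Relation.Unary.AllPairs.Properties as AllPairs
open import Data.List.Relation.Unary.Any using (here; there)
import Data.List.Relation.Unary.Unique.Propositional as List
import Data.List.Relation.Unary.Unique.Propositional.Properties as Unique
open import Data.Nat.Base as ℕ using (ℕ; NonZero; _≤_; _*_)
import Data.Nat.Properties as ℕ
import Data.Nat.Solver
open import Data.Product.Base using (∃; _×_; _,_; proj₁; proj₂; uncurry; map₂)
open import Data.Product.Properties using (≡-dec)
open import Data.Rational.Base as ℚ using (ℚ; 0ℚ; 1ℚ; ½; _/_)
import Data.Rational.Properties as ℚ
open import Data.Rational.Solver using (module +-*-Solver)
open import Data.Sum.Base using (inj₁; inj₂; [_,_]′)
open import Data.Vec.Base as Vec using (Vec; []; _∷_)
open import Data.Vec.Membership.Propositional using (_∈_; find)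
import Data.Vec.Membership.Propositional.Properties as Vec
import Data.Vec.Properties as Vec
open import Data.Vec.Relation.Unary.All using ([]; _∷_) renaming (All to VecAll)
open import Data.Vec.Relation.Unary.AllPairs using (allPairs?)
open import Data.Vec.Relation.Unary.Any as VecAny using (any?)
import Data.Vec.Relation.Unary.Any.Properties as VecAny
open import Data.Vec.Relation.Unary.Unique.Propositional using (Unique)
import Data.Vec.Relation.Unary.Unique.Propositional.Properties as VecUnique
open import Function.Base using (_∘_; id)
open import Function.Bundles using (_⇔_; mk⇔; Equivalence)
open import Relation.Binary.PropositionalEquality hiding ([_])
open import Relation.Nullary.Decidable using (Dec; does; yes; no; dec-true; dec-false; does-⇔; from-yes;
  decidable-stable; _→-dec_; ¬?; _×-dec_)
open import Relation.Nullary.Negation using (¬_; contradiction)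

open import Algebra.Properties.CommutativeMonoid.Sum ℚ.+-0-commutativeMonoid using (sum; sum-cong-≗; ∑-distrib-+)
open import Algebra.Properties.CommutativeMonoid.Sum ℕ.+-0-commutativeMonoid
  using () renaming (sum to Σℕ; sum-cong-≗ to Σℕ-cong; ∑-distrib-+ to Σℕ-distrib-+)
open import Algebra.Properties.Semiring.Sum ℕ.+-*-semiring using () renaming (*-distribˡ-sum to *-distribˡ-Σℕ)

-- Mixtures of proper colourings

-- The bound 1/6 is met exactly on the gadgets. In a mixture every vertex has each colour with mass
-- at most 3 · 1/6 = 1/2. If the terminals have colour `s`, the three choices turn each gadget
-- hyperedge into the three not-all-equal triples with head `s`, once each, so every triple receives
-- at most 1/2 · 1/3 = 1/6. A single fixed choice could put mass 1/2 on one triple, hence the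
-- averaging.
--
-- Mixtures are lists of weighted colourings. Passing between the two hypergraphs is then a map on
-- colourings, for which no two colourings ever have to be compared; the enumeration of assignments
-- by `Fin (2 ^ n)` is confined to the conversion from and to feasible `b`.
--
-- The program is chosen before the arrangement and never sees it. This is possible because the
-- order of the copies along a path affects neither the number of its links nor the colours of their
-- auxiliary vertices.

𝟙 : ∀ {P : Set} → Dec P → ℚ
𝟙 P? = if does P? then 1ℚ else 0ℚ

𝟙-true : ∀ {P : Set} (P? : Dec P) → P → 𝟙 P? ≡ 1ℚ
𝟙-true P? p = cong (if_then 1ℚ else 0ℚ) (dec-true P? p)

𝟙-false : ∀ {P : Set} (P? : Dec P) → ¬ P → 𝟙 P? ≡ 0ℚ
𝟙-false P? ¬p = cong (if_then 1ℚ else 0ℚ) (dec-false P? ¬p)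

𝟙≥0 : ∀ {P : Set} (P? : Dec P) → 0ℚ ℚ.≤ 𝟙 P?
𝟙≥0 P? with does P?
... | true  = ℚ.nonNegative⁻¹ 1ℚ
... | false = ℚ.≤-refl

𝟙-mono : ∀ {P Q : Set} (P? : Dec P) (Q? : Dec Q) → (P → Q) → 𝟙 P? ℚ.≤ 𝟙 Q?
𝟙-mono (yes p) Q? f = ℚ.≤-reflexive (sym (𝟙-true Q? (f p)))
𝟙-mono (no _)  Q? f = 𝟙≥0 Q?

-- Finitely supported measures; a point may be listed more than once.
Weighted : Set → Set
Weighted A = List (ℚ × A)

NonNegWeights : ∀ {A} → Weighted A → Set
NonNegWeights = All λ (w , _) → 0ℚ ℚ.≤ w

-- Points of weight 0 are exempt: a feasible `b` is listed over all global assignments, and those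
-- that the tables forbid appear with weight 0.
AlmostAll : ∀ {A} → (A → Set) → Weighted A → Set
AlmostAll P = All λ (w , x) → w ≢ 0ℚ → P x

∫ : ∀ {A} → (A → ℚ) → Weighted A → ℚ
∫ f []             = 0ℚ
∫ f ((w , x) ∷ xs) = w ℚ.* f x ℚ.+ ∫ f xs

module _ {A : Set} where
  open +-*-Solver using (solve; _:=_; _:+_; _:*_)

  ∫-mono : ∀ {f g : A → ℚ} {xs} → NonNegWeights xs → AlmostAll (λ x → f x ℚ.≤ g x) xs → ∫ f xs ℚ.≤ ∫ g xs
  ∫-mono [] [] = ℚ.≤-refl
  ∫-mono {f} {g} {(w , x) ∷ _} (w≥0 ∷ ws) (h ∷ hs) = ℚ.+-mono-≤ head (∫-mono ws hs)
    where
    head : w ℚ.* f x ℚ.≤ w ℚ.* g x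
    head with w ℚ.≟ 0ℚ
    ... | yes refl = ℚ.≤-reflexive (trans (ℚ.*-zeroˡ (f x)) (sym (ℚ.*-zeroˡ (g x))))
    ... | no w≢0   = ℚ.*-monoˡ-≤-nonNeg w ⦃ ℚ.nonNegative w≥0 ⦄ (h w≢0)

  ∫-mono′ : ∀ {f g : A → ℚ} {xs} → NonNegWeights xs → (∀ x → f x ℚ.≤ g x) → ∫ f xs ℚ.≤ ∫ g xs
  ∫-mono′ {xs = xs} ws h = ∫-mono ws (All.universal (λ (_ , x) _ → h x) xs)

  ∫-zero : ∀ (xs : Weighted A) → ∫ (λ _ → 0ℚ) xs ≡ 0ℚ
  ∫-zero []             = refl
  ∫-zero ((w , _) ∷ xs) = cong₂ ℚ._+_ (ℚ.*-zeroʳ w) (∫-zero xs)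

  ∫-+ : ∀ (f g : A → ℚ) xs → ∫ (λ x → f x ℚ.+ g x) xs ≡ ∫ f xs ℚ.+ ∫ g xs
  ∫-+ f g []             = refl
  ∫-+ f g ((w , x) ∷ xs) rewrite ∫-+ f g xs =
    solve 5 (λ w a b y z → w :* (a :+ b) :+ (y :+ z) := (w :* a :+ y) :+ (w :* b :+ z))
      refl w (f x) (g x) (∫ f xs) (∫ g xs)

  ∫-* : ∀ c (f : A → ℚ) xs → ∫ (λ x → c ℚ.* f x) xs ≡ c ℚ.* ∫ f xs
  ∫-* c f []             = sym (ℚ.*-zeroʳ c)
  ∫-* c f ((w , x) ∷ xs) rewrite ∫-* c f xs =
    solve 4 (λ c w a y → w :* (c :* a) :+ c :* y := c :* (w :* a :+ y)) refl c w (f x) (∫ f xs)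

  ∫-map : ∀ {B : Set} (f : B → ℚ) (h : A → B) xs → ∫ f (List.map (map₂ h) xs) ≡ ∫ (f ∘ h) xs
  ∫-map f h []             = refl
  ∫-map f h ((w , x) ∷ xs) = cong (w ℚ.* f (h x) ℚ.+_) (∫-map f h xs)

  ∫≥0 : ∀ {f : A → ℚ} {xs} → NonNegWeights xs → (∀ x → 0ℚ ℚ.≤ f x) → 0ℚ ℚ.≤ ∫ f xs
  ∫≥0 {f} {xs} ws f≥0 = subst (ℚ._≤ ∫ f xs) (∫-zero xs) (∫-mono′ ws f≥0)

  term≤∫ : ∀ {f : A → ℚ} {xs} → NonNegWeights xs → (∀ x → 0ℚ ℚ.≤ f x) →
           All (λ (w , x) → w ℚ.* f x ℚ.≤ ∫ f xs) xs
  term≤∫ [] _ = []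
  term≤∫ {f} {(w , x) ∷ xs} (w≥0 ∷ ws) f≥0 =
      subst (ℚ._≤ w ℚ.* f x ℚ.+ ∫ f xs) (ℚ.+-identityʳ _) (ℚ.+-monoʳ-≤ (w ℚ.* f x) (∫≥0 ws f≥0))
    ∷ All.map (λ {(v , y)} le → subst (ℚ._≤ w ℚ.* f x ℚ.+ ∫ f xs) (ℚ.+-identityˡ _)
        (ℚ.+-mono-≤ wfx≥0 le)) (term≤∫ ws f≥0)
    where
    wfx≥0 : 0ℚ ℚ.≤ w ℚ.* f x
    wfx≥0 = subst (ℚ._≤ w ℚ.* f x) (ℚ.*-zeroʳ w) (ℚ.*-monoˡ-≤-nonNeg w ⦃ ℚ.nonNegative w≥0 ⦄ (f≥0 x))

  -- The point `x` alone contributes `w` to the mass of the outcome `r x`, so if `m (r x)` is 0,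
  -- then `w` lies between 0 and 0.
  mass≢0-on-support : ∀ {k} (r : A → Outcomes k) (m : Outcomes k → ℚ) {xs} → NonNegWeights xs →
    (∀ u → ∫ (λ x → 𝟙 (r x ≟ᵒ u)) xs ℚ.≤ m u) → AlmostAll (λ x → m (r x) ≢ 0ℚ) xs
  mass≢0-on-support r m {xs} ws bound = All.tabulate λ {(w , x)} wx∈xs w≢0 m≡0 →
    w≢0 (ℚ.≤-antisym
      (subst₂ ℚ._≤_ (trans (cong (w ℚ.*_) (𝟙-true (r x ≟ᵒ r x) refl)) (ℚ.*-identityʳ w)) m≡0
        (ℚ.≤-trans (All.lookup (term≤∫ ws (λ y → 𝟙≥0 (r y ≟ᵒ r x))) wx∈xs) (bound (r x))))
      (All.lookup ws wx∈xs))

sum-∫ : ∀ {A : Set} {n} (p : A → Bool) (b : Fin n → ℚ) (h : Fin n → A) →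
  sum (λ i → if p (h i) then b i else 0ℚ) ≡ ∫ (λ x → if p x then 1ℚ else 0ℚ) (List.tabulate λ i → b i , h i)
sum-∫ {n = ℕ.zero}  p b h = refl
sum-∫ {n = ℕ.suc _} p b h = cong₂ ℚ._+_ (head (p (h zero))) (sum-∫ p (b ∘ suc) (h ∘ suc))
  where
  head : ∀ c → (if c then b zero else 0ℚ) ≡ b zero ℚ.* (if c then 1ℚ else 0ℚ)
  head true  = sym (ℚ.*-identityʳ (b zero))
  head false = sym (ℚ.*-zeroʳ (b zero))

sum-𝟙 : ∀ {n} (j : Fin n) (f : Fin n → ℚ) → sum (λ i → f i ℚ.* 𝟙 (j Fin.≟ i)) ≡ f j
sum-𝟙 zero f = trans (cong₂ ℚ._+_ (ℚ.*-identityʳ (f zero)) (sum-zero λ i → ℚ.*-zeroʳ (f (suc i)))) (ℚ.+-identityʳ (f zero))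
sum-𝟙 (suc j) f = trans (cong₂ ℚ._+_ (ℚ.*-zeroʳ (f zero)) (sum-𝟙 j (f ∘ suc))) (ℚ.+-identityˡ (f (suc j)))

-- Each listed point lies over exactly one `i`. With `p` a test on restrictions this computes the
-- marginals of the image of a mixture, with `p` constantly true its total mass.
sum-fibres : ∀ {A : Set} {n} (p : Fin n → Bool) (h : A → Fin n) xs →
  sum (λ i → if p i then ∫ (λ x → 𝟙 (h x Fin.≟ i)) xs else 0ℚ) ≡ ∫ (λ x → if p (h x) then 1ℚ else 0ℚ) xs
sum-fibres p h [] = sum-zero (λ i → lemma (p i))
  where
  lemma : ∀ c → (if c then 0ℚ else 0ℚ) ≡ 0ℚ
  lemma true  = refl
  lemma false = refl
sum-fibres p h ((w , x) ∷ xs) = begin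
  sum (λ i → if p i then w ℚ.* 𝟙 (h x Fin.≟ i) ℚ.+ ∫ (λ y → 𝟙 (h y Fin.≟ i)) xs else 0ℚ)
    ≡⟨ sum-cong-≗ (λ i → lemma (p i) (𝟙 (h x Fin.≟ i)) _) ⟩
  sum (λ i → w ℚ.* (if p i then 1ℚ else 0ℚ) ℚ.* 𝟙 (h x Fin.≟ i) ℚ.+ (if p i then ∫ (λ y → 𝟙 (h y Fin.≟ i)) xs else 0ℚ))
    ≡⟨ ∑-distrib-+ (λ i → w ℚ.* (if p i then 1ℚ else 0ℚ) ℚ.* 𝟙 (h x Fin.≟ i)) _ ⟩
  sum (λ i → w ℚ.* (if p i then 1ℚ else 0ℚ) ℚ.* 𝟙 (h x Fin.≟ i)) ℚ.+ sum (λ i → if p i then ∫ (λ y → 𝟙 (h y Fin.≟ i)) xs else 0ℚ)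
    ≡⟨ cong₂ ℚ._+_ (sum-𝟙 (h x) (λ i → w ℚ.* (if p i then 1ℚ else 0ℚ))) (sum-fibres p h xs) ⟩
  w ℚ.* (if p (h x) then 1ℚ else 0ℚ) ℚ.+ ∫ (λ y → if p (h y) then 1ℚ else 0ℚ) xs ∎
  where
  open ≡-Reasoning
  lemma : ∀ c δ r → (if c then w ℚ.* δ ℚ.+ r else 0ℚ) ≡ w ℚ.* (if c then 1ℚ else 0ℚ) ℚ.* δ ℚ.+ (if c then r else 0ℚ)
  lemma true  δ r = cong (λ v → v ℚ.* δ ℚ.+ r) (sym (ℚ.*-identityʳ w))
  lemma false δ r = sym (trans (ℚ.+-identityʳ _) (trans (cong (ℚ._* δ) (ℚ.*-zeroʳ w)) (ℚ.*-zeroˡ δ)))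

map≡tabulate : ∀ {A B : Set} {n} (f : A → B) (xs : Vec A n) → Vec.map f xs ≡ Vec.tabulate (f ∘ Vec.lookup xs)
map≡tabulate f xs = trans (cong (Vec.map f) (sym (Vec.tabulate∘lookup xs))) (sym (Vec.tabulate-∘ f (Vec.lookup xs)))

NAEColouring : (H : Hypergraph) → Colouring H → Set
NAEColouring H χ = ∀ e → NAE₃ (Vec.map χ (edge H e))

record Mixture (H : Hypergraph) (q : ℚ) : Set where
  field
    terms   : Weighted (Colouring H)
    weight≥0 : NonNegWeights terms
    bound   : ∀ e u → ∫ (λ χ → 𝟙 (Vec.map χ (edge H e) ≟ᵒ u)) terms ℚ.≤ mass uniformNAE u
    ∫1≡    : ∫ (λ _ → 1ℚ) terms ≡ q

  nae-on-support : AlmostAll (NAEColouring H) terms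
  nae-on-support = All.tabulate λ {(w , χ)} wχ∈ w≢0 e →
    let u = Vec.map χ (edge H e) in
    decidable-stable (NAE₃? u) λ ¬nae →
      All.lookup (mass≢0-on-support (λ χ → Vec.map χ (edge H e)) (mass uniformNAE) weight≥0 (bound e)) wχ∈ w≢0
        (cong (if_then ℤ.+ 1 / 6 else 0ℚ) (dec-false (NAE₃? u) ¬nae))

  -- Of the four triples with `s` in position `j`, which `at` enumerates, exactly one is constant;
  -- the other three have mass 1/6 each.
  half : ∀ (o : Occurrence H) s → ∫ (λ χ → 𝟙 (χ (vertexAt H o) Fin.≟ s)) terms ℚ.≤ ½
  half (e , j) s = begin
    ∫ (λ χ → 𝟙 (χ (vertexAt H (e , j)) Fin.≟ s)) terms
      ≤⟨ ∫-mono′ weight≥0 (λ χ → subst (λ v → 𝟙 (v Fin.≟ s) ℚ.≤ cover (Vec.map χ (edge H e)) j s)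
           (Vec.lookup-map j χ (edge H e)) (covers (Vec.map χ (edge H e)) j s)) ⟩
    ∫ (λ χ → cover (Vec.map χ (edge H e)) j s) terms
      ≡⟨ trans (∫-+ _ _ terms) (cong₂ ℚ._+_ (∫-+ _ _ terms) (∫-+ _ _ terms)) ⟩
    (M (at j s 0F 0F) ℚ.+ M (at j s 0F 1F)) ℚ.+ (M (at j s 1F 0F) ℚ.+ M (at j s 1F 1F))
      ≤⟨ ℚ.+-mono-≤ (ℚ.+-mono-≤ (bound e _) (bound e _)) (ℚ.+-mono-≤ (bound e _) (bound e _)) ⟩
    (m (at j s 0F 0F) ℚ.+ m (at j s 0F 1F)) ℚ.+ (m (at j s 1F 0F) ℚ.+ m (at j s 1F 1F))
      ≡⟨ masses j s ⟩
    ½ ∎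
    where
    open ℚ.≤-Reasoning
    m M : Outcomes 3 → ℚ
    m = mass uniformNAE
    M u = ∫ (λ χ → 𝟙 (Vec.map χ (edge H e) ≟ᵒ u)) terms
    at : Fin 3 → Fin 2 → Fin 2 → Fin 2 → Outcomes 3
    at j s a b = Vec.insertAt (a ∷ b ∷ []) j s
    cover : Outcomes 3 → Fin 3 → Fin 2 → ℚ
    cover w j s = (𝟙 (w ≟ᵒ at j s 0F 0F) ℚ.+ 𝟙 (w ≟ᵒ at j s 0F 1F)) ℚ.+ (𝟙 (w ≟ᵒ at j s 1F 0F) ℚ.+ 𝟙 (w ≟ᵒ at j s 1F 1F))
    -- The triple is taken apart so that every quantifier ranges over some `Fin`; the inequality is
    -- then decided by evaluation.
    covers : ∀ w j s → 𝟙 (Vec.lookup w j Fin.≟ s) ℚ.≤ cover w j s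
    covers (x ∷ y ∷ z ∷ []) = from-yes (Fin.all? λ x → Fin.all? λ y → Fin.all? λ z → Fin.all? λ j → Fin.all? λ s →
      𝟙 (Vec.lookup (x ∷ y ∷ z ∷ []) j Fin.≟ s) ℚ.≤? cover (x ∷ y ∷ z ∷ []) j s) x y z
    masses : ∀ j s → (m (at j s 0F 0F) ℚ.+ m (at j s 0F 1F)) ℚ.+ (m (at j s 1F 0F) ℚ.+ m (at j s 1F 1F)) ≡ ½
    masses = from-yes (Fin.all? λ j → Fin.all? λ s →
      (m (at j s 0F 0F) ℚ.+ m (at j s 0F 1F)) ℚ.+ (m (at j s 1F 0F) ℚ.+ m (at j s 1F 1F)) ℚ.≟ ½)

-- Mixtures and feasible solutions

module _ (H : Hypergraph) where
  naeContext : Fin (#E H) → Context (#V H ℕ.+ #E H ℕ.* 3)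
  naeContext e = Vec.tabulate (λ j → fresh H (e , j)) ◂ uniformNAE

  eqContext : Occurrence H → Context (#V H ℕ.+ #E H ℕ.* 3)
  eqContext o = (central H (vertexAt H o) ∷ fresh H o ∷ []) ◂ uniformEq

  module _ {P : Context (#V H ℕ.+ #E H ℕ.* 3) → Set} where
    All-naeContexts⁺ : (∀ e → P (naeContext e)) → (∀ o → P (eqContext o)) → All P (naeContexts H)
    All-naeContexts⁺ p q = All.concat⁺ (All.map⁺ (All.tabulate⁺ λ e →
      p e ∷ All.map⁺ {f = λ j → eqContext (e , j)} (All.tabulate⁺ {f = id} λ j → q (e , j))))

    All-naeContexts⁻ : All P (naeContexts H) → (∀ e → P (naeContext e)) × (∀ o → P (eqContext o))
    All-naeContexts⁻ ps = (λ e → All.head (block e)) , λ (e , j) →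
      All.tabulate⁻ {f = id} (All.map⁻ {f = λ j → eqContext (e , j)} (All.tail (block e))) j
      where
      block = All.tabulate⁻ (All.map⁻ {xs = List.allFin (#E H)} (All.concat⁻ ps))

  module _ (ni : NoIsolated H) (nz : NonZero (#E H)) where
    private M = naeModel H ni nz

    feasible⇒mixture : ∀ b → Feasible M b → Mixture H (sum b)
    feasible⇒mixture b (b≥0 , feasible) = record
      { terms    = List.map (map₂ centralPart) points
      ; weight≥0 = All.map⁺ points≥0
      ; bound    = λ e u → begin
          ∫ (λ χ → 𝟙 (Vec.map χ (edge H e) ≟ᵒ u)) (List.map (map₂ centralPart) points)
            ≡⟨ ∫-map _ centralPart points ⟩
          ∫ (λ g → 𝟙 (Vec.map (centralPart g) (edge H e) ≟ᵒ u)) points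
            -- The equality tables vanish off the diagonal. So at nonzero weight each fresh
            -- observable repeats its central one, and the triple may be read at either.
            ≤⟨ ∫-mono points≥0 (All.tabulate λ {(w , g)} wg∈ w≢0 →
                 ℚ.≤-reflexive (cong (λ v → 𝟙 (v ≟ᵒ u)) (agree e g λ j → All.lookup (equal (e , j)) wg∈ w≢0))) ⟩
          ∫ (λ g → 𝟙 (restrict M g (naeContext e) ≟ᵒ u)) points
            ≤⟨ marginal≤ (naeContext e) (proj₁ bounds e) u ⟩
          mass uniformNAE u ∎
      ; ∫1≡      = trans (∫-map _ centralPart points) (sym (sum-∫ (λ _ → true) b id))
      }
      where
      open ℚ.≤-Reasoning
      centralPart : Global M → Colouring H
      centralPart g v = finToFun g (central H v)
      points : Weighted (Global M)
      points = List.tabulate λ g → b g , g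
      points≥0 : NonNegWeights points
      points≥0 = All.tabulate⁺ b≥0
      bounds = All-naeContexts⁻ feasible
      marginal≤ : ∀ C → (∀ u → marginal M b C u ℚ.≤ mass (table C) u) →
                  ∀ u → ∫ (λ g → 𝟙 (restrict M g C ≟ᵒ u)) points ℚ.≤ mass (table C) u
      marginal≤ C h u = subst (ℚ._≤ mass (table C) u) (sum-∫ (λ g → does (restrict M g C ≟ᵒ u)) b id) (h u)
      diagonal : ∀ x y → mass uniformEq (x ∷ y ∷ []) ≢ 0ℚ → x ≡ y
      diagonal 0F 0F _ = refl
      diagonal 1F 1F _ = refl
      diagonal 0F 1F h = contradiction refl h
      diagonal 1F 0F h = contradiction refl h
      equal : ∀ o → AlmostAll (λ g → finToFun g (central H (vertexAt H o)) ≡ finToFun g (fresh H o)) points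
      equal o = All.map (λ h w≢0 → diagonal _ _ (h w≢0))
        (mass≢0-on-support (λ g → restrict M g (eqContext o)) (mass uniformEq) points≥0 (marginal≤ (eqContext o) (proj₂ bounds o)))
      agree : ∀ e g → (∀ j → finToFun g (central H (vertexAt H (e , j))) ≡ finToFun g (fresh H (e , j))) →
              Vec.map (centralPart g) (edge H e) ≡ restrict M g (naeContext e)
      agree e g h = trans (map≡tabulate (centralPart g) (edge H e))
        (trans (Vec.tabulate-cong h) (Vec.tabulate-∘ (finToFun g) (λ j → fresh H (e , j))))

    mixture⇒feasible : ∀ {q} → Mixture H q → ∃ λ b → Feasible M b × sum b ≡ q
    mixture⇒feasible {q} mixture = b
      , ((λ g → ∫≥0 weight≥0 (λ χ → 𝟙≥0 (encode χ Fin.≟ g))) , All-naeContexts⁺ nae≤ eq≤)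
      , trans (sum-fibres (λ _ → true) encode terms) ∫1≡
      where
      open Mixture mixture
      -- Fresh observables repeat the colour of their vertex, so the equality contexts see diagonal
      -- pairs only, which `half` bounds.
      values : Colouring H → Fin (#Obs M) → Fin 2
      values χ = [ χ , χ ∘ vertexAt H ∘ remQuot 3 ]′ ∘ splitAt (#V H)
      encode : Colouring H → Global M
      encode χ = funToFin (values χ)
      b : Global M → ℚ
      b g = ∫ (λ χ → 𝟙 (encode χ Fin.≟ g)) terms
      marginal≡ : ∀ C u → marginal M b C u ≡ ∫ (λ χ → 𝟙 (restrict M (encode χ) C ≟ᵒ u)) terms
      marginal≡ C u = sum-fibres (λ g → does (restrict M g C ≟ᵒ u)) encode terms
      decode-central : ∀ χ v → finToFun (encode χ) (central H v) ≡ χ v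
      decode-central χ v = trans (Fin.finToFun-funToFin (values χ) (central H v))
        (cong [ χ , χ ∘ vertexAt H ∘ remQuot 3 ]′ (Fin.splitAt-↑ˡ (#V H) v (#E H ℕ.* 3)))
      decode-fresh : ∀ χ o → finToFun (encode χ) (fresh H o) ≡ χ (vertexAt H o)
      decode-fresh χ (e , j) = trans (Fin.finToFun-funToFin (values χ) (fresh H (e , j)))
        (trans (cong [ χ , χ ∘ vertexAt H ∘ remQuot 3 ]′ (Fin.splitAt-↑ʳ (#V H) (#E H ℕ.* 3) (combine e j)))
          (cong (χ ∘ vertexAt H) (Fin.remQuot-combine e j)))
      restrict-nae : ∀ χ e → restrict M (encode χ) (naeContext e) ≡ Vec.map χ (edge H e)
      restrict-nae χ e = trans (sym (Vec.tabulate-∘ (finToFun (encode χ)) (λ j → fresh H (e , j))))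
        (trans (Vec.tabulate-cong (λ j → decode-fresh χ (e , j))) (sym (map≡tabulate χ (edge H e))))
      nae≤ : ∀ e u → marginal M b (naeContext e) u ℚ.≤ mass uniformNAE u
      nae≤ e u = ℚ.≤-trans (ℚ.≤-reflexive (marginal≡ (naeContext e) u))
        (ℚ.≤-trans (∫-mono′ weight≥0 (λ χ → ℚ.≤-reflexive (cong (λ v → 𝟙 (v ≟ᵒ u)) (restrict-nae χ e)))) (bound e u))
      pair≤ : ∀ o x y → ∫ (λ χ → 𝟙 (restrict M (encode χ) (eqContext o) ≟ᵒ x ∷ y ∷ [])) terms ℚ.≤ mass uniformEq (x ∷ y ∷ [])
      pair≤ o x y = ℚ.≤-trans (∫-mono′ weight≥0 (λ χ → ℚ.≤-reflexive (cong₂ (λ v w → 𝟙 (v ∷ w ∷ [] ≟ᵒ x ∷ y ∷ []))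
          (decode-central χ (vertexAt H o)) (decode-fresh χ o))))
        (cases x y)
        where
        same : ∀ s → ∫ (λ χ → 𝟙 (χ (vertexAt H o) ∷ χ (vertexAt H o) ∷ [] ≟ᵒ s ∷ s ∷ [])) terms ℚ.≤ ½
        same s = ℚ.≤-trans (∫-mono′ weight≥0 λ χ → 𝟙-mono (χ (vertexAt H o) ∷ χ (vertexAt H o) ∷ [] ≟ᵒ s ∷ s ∷ [])
            (χ (vertexAt H o) Fin.≟ s) (cong Vec.head)) (half o s)
        distinct : ∀ s t → s ≢ t → ∫ (λ χ → 𝟙 (χ (vertexAt H o) ∷ χ (vertexAt H o) ∷ [] ≟ᵒ s ∷ t ∷ [])) terms ℚ.≤ 0ℚ
        distinct s t s≢t = ℚ.≤-trans (∫-mono′ weight≥0 λ χ →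
            ℚ.≤-reflexive (𝟙-false (χ (vertexAt H o) ∷ χ (vertexAt H o) ∷ [] ≟ᵒ s ∷ t ∷ []) λ eq →
              s≢t (trans (sym (cong Vec.head eq)) (cong (Vec.head ∘ Vec.tail) eq))))
          (ℚ.≤-reflexive (∫-zero terms))
        cases : ∀ x y → ∫ (λ χ → 𝟙 (χ (vertexAt H o) ∷ χ (vertexAt H o) ∷ [] ≟ᵒ x ∷ y ∷ [])) terms ℚ.≤ mass uniformEq (x ∷ y ∷ [])
        cases 0F 0F = same 0F
        cases 1F 1F = same 1F
        cases 0F 1F = distinct 0F 1F λ ()
        cases 1F 0F = distinct 1F 0F λ ()
      eq≤ : ∀ o u → marginal M b (eqContext o) u ℚ.≤ mass uniformEq u
      eq≤ o (x ∷ y ∷ []) = ℚ.≤-trans (ℚ.≤-reflexive (marginal≡ (eqContext o) (x ∷ y ∷ []))) (pair≤ o x y)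

    NCF-mixture : Mixture H (NCF M)
    NCF-mixture with NCF-isNCF M
    ... | (b , feasible , sum≡) , _ = subst (Mixture H) sum≡ (feasible⇒mixture b feasible)

    mixture≤NCF : ∀ {q} → Mixture H q → q ℚ.≤ NCF M
    mixture≤NCF mixture with mixture⇒feasible mixture
    ... | b , feasible , refl = proj₂ (NCF-isNCF M) b feasible

-- Hyperedges and degrees of the compilation

module _ {A : Set} where
  consecutive-length : ∀ (xs : List A) → List.length (consecutive xs) ≡ ℕ.pred (List.length xs)
  consecutive-length []           = refl
  consecutive-length (x ∷ [])     = refl
  consecutive-length (x ∷ y ∷ xs) = cong ℕ.suc (consecutive-length (y ∷ xs))

  All-consecutive : ∀ {P : A → Set} {xs} → All P xs → All (λ (x , y) → P x × P y) (consecutive xs)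
  All-consecutive []             = []
  All-consecutive (px ∷ [])      = []
  All-consecutive (px ∷ py ∷ ps) = (px , py) ∷ All-consecutive (py ∷ ps)

  consecutive-≢ : ∀ {xs : List A} → List.Unique xs → All (uncurry _≢_) (consecutive xs)
  consecutive-≢ AllPairs.[]                           = []
  consecutive-≢ (_ AllPairs.∷ AllPairs.[])            = []
  consecutive-≢ ((x≢y ∷ _) AllPairs.∷ u@(_ AllPairs.∷ _)) = x≢y ∷ consecutive-≢ u

  -- These are the entries other than the last. Together with `map-proj₂-consecutive` this makes an
  -- occurrence the left end of at most one link and the right end of at most one.
  unique-consecutive₁ : ∀ {xs : List A} → List.Unique xs → List.Unique (List.map proj₁ (consecutive xs))
  unique-consecutive₁ AllPairs.[]                = AllPairs.[]
  unique-consecutive₁ (_ AllPairs.∷ AllPairs.[]) = AllPairs.[]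
  unique-consecutive₁ ((x≢y ∷ x≢) AllPairs.∷ u@(_ AllPairs.∷ _)) =
    All.map⁺ (All.map proj₁ (All-consecutive (x≢y ∷ x≢))) AllPairs.∷ unique-consecutive₁ u

  map-proj₂-consecutive : ∀ (xs : List A) → List.map proj₂ (consecutive xs) ≡ List.drop 1 xs
  map-proj₂-consecutive []           = refl
  map-proj₂-consecutive (x ∷ [])     = refl
  map-proj₂-consecutive (x ∷ y ∷ xs) = cong (y ∷_) (map-proj₂-consecutive (y ∷ xs))

  constant-along : ∀ {B : Set} (f : A → B) {xs} → All (λ (x , y) → f x ≡ f y) (consecutive xs) →
                   ∀ {x y} → x List.∈ xs → y List.∈ xs → f x ≡ f y
  constant-along f {z ∷ zs} h x∈ y∈ = trans (sym (fromHead h x∈)) (fromHead h y∈)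
    where
    fromHead : ∀ {z zs y} → All (λ (x , y) → f x ≡ f y) (consecutive (z ∷ zs)) → y List.∈ z ∷ zs → f z ≡ f y
    fromHead              _        (here refl) = refl
    fromHead {zs = _ ∷ _} (e ∷ es) (there y∈)  = trans e (fromHead es y∈)

lookup-map-injective : ∀ {A B : Set} {f : A → B} {xs} → List.Unique (List.map f xs) →
  ∀ i j → f (List.lookup xs i) ≡ f (List.lookup xs j) → i ≡ j
lookup-map-injective {xs = _ ∷ _} _ zero zero _ = refl
lookup-map-injective {f = f} {xs = _ ∷ xs} (x∉ AllPairs.∷ _) zero (suc j) eq =
  contradiction eq (All.lookup x∉ (List.∈-map⁺ f (List.∈-lookup {xs = xs} j)))
lookup-map-injective {f = f} {xs = _ ∷ xs} (x∉ AllPairs.∷ _) (suc i) zero eq =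
  contradiction (sym eq) (All.lookup x∉ (List.∈-map⁺ f (List.∈-lookup {xs = xs} i)))
lookup-map-injective {xs = _ ∷ _} (_ AllPairs.∷ u) (suc i) (suc j) eq = cong suc (lookup-map-injective u i j eq)

-- Degrees as sums of indicators

indicator : ∀ {P : Set} → Dec P → ℕ
indicator P? = if does P? then 1 else 0

indicator-⇔ : ∀ {P Q : Set} (P? : Dec P) (Q? : Dec Q) → P ⇔ Q → indicator P? ≡ indicator Q?
indicator-⇔ P? Q? P⇔Q = cong (if_then 1 else 0) (does-⇔ P⇔Q P? Q?)

indicator-false : ∀ {P : Set} (P? : Dec P) → ¬ P → indicator P? ≡ 0
indicator-false P? ¬p = cong (if_then 1 else 0) (dec-false P? ¬p)

length-filter-tabulate : ∀ {A : Set} {P : A → Set} (P? : ∀ x → Dec (P x)) {n} (f : Fin n → A) →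
  List.length (List.filter P? (List.tabulate f)) ≡ Σℕ (indicator ∘ P? ∘ f)
length-filter-tabulate P? {ℕ.zero}  f = refl
length-filter-tabulate P? {ℕ.suc n} f with does (P? (f zero))
... | true  = cong ℕ.suc (length-filter-tabulate P? (f ∘ suc))
... | false = length-filter-tabulate P? (f ∘ suc)

Σℕ-↑ : ∀ m {n} (f : Fin (m ℕ.+ n) → ℕ) → Σℕ f ≡ Σℕ (f ∘ (_↑ˡ n)) ℕ.+ Σℕ (f ∘ (m ↑ʳ_))
Σℕ-↑ ℕ.zero    f = refl
Σℕ-↑ (ℕ.suc m) f = trans (cong (f zero ℕ.+_) (Σℕ-↑ m (f ∘ suc))) (sym (ℕ.+-assoc (f zero) _ _))

Σℕ-combine : ∀ m {n} (f : Fin (m ℕ.* n) → ℕ) → Σℕ f ≡ Σℕ {m} (λ i → Σℕ {n} (λ j → f (combine i j)))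
Σℕ-combine ℕ.zero        f = refl
Σℕ-combine (ℕ.suc m) {n} f = trans (Σℕ-↑ n f) (cong (Σℕ (f ∘ (_↑ˡ (m ℕ.* n))) ℕ.+_) (Σℕ-combine m (f ∘ (n ↑ʳ_))))

Σℕ-mono : ∀ {n} {f g : Fin n → ℕ} → (∀ i → f i ℕ.≤ g i) → Σℕ f ℕ.≤ Σℕ g
Σℕ-mono {ℕ.zero}  h = ℕ.z≤n
Σℕ-mono {ℕ.suc n} h = ℕ.+-mono-≤ (h zero) (Σℕ-mono (h ∘ suc))

Σℕ-zero : ∀ {n} {f : Fin n → ℕ} → (∀ i → f i ≡ 0) → Σℕ f ≡ 0
Σℕ-zero {ℕ.zero}  h = refl
Σℕ-zero {ℕ.suc n} h = cong₂ ℕ._+_ (h zero) (Σℕ-zero (h ∘ suc))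

Σℕ-indicator-≤1 : ∀ {n} {P : Fin n → Set} (P? : ∀ i → Dec (P i)) → (∀ {i j} → P i → P j → i ≡ j) →
  Σℕ (indicator ∘ P?) ℕ.≤ 1
Σℕ-indicator-≤1 {ℕ.zero}  P? unique = ℕ.z≤n
Σℕ-indicator-≤1 {ℕ.suc n} P? unique with P? zero
... | yes p = ℕ.≤-reflexive (cong ℕ.suc (Σℕ-zero λ i → indicator-false (P? (suc i)) λ q → contradiction (unique p q) λ ()))
... | no _  = Σℕ-indicator-≤1 (P? ∘ suc) λ p q → Fin.suc-injective (unique p q)

Σℕ-indicator-≡ : ∀ {n} (j : Fin n) → Σℕ (λ i → indicator (i Fin.≟ j)) ≡ 1
Σℕ-indicator-≡ {ℕ.suc n} zero = cong ℕ.suc (Σℕ-zero {n} λ _ → refl)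
Σℕ-indicator-≡ (suc j) = Σℕ-indicator-≡ j

-- The gadget with the variables x, y, a, b, c numbered from 0 to 4.
shape : Fin 6 → Vec (Fin 5) 3
shape = Vec.lookup (𝒬 0F 1F 2F 3F 4F)

_∈?_ : ∀ {n k} (v : Fin n) (xs : Vec (Fin n) k) → Dec (v ∈ xs)
v ∈? xs = any? (v Fin.≟_) xs

shape-unique : ∀ i → Unique (shape i)
shape-unique = from-yes (Fin.all? λ i → allPairs? (λ x y → ¬? (x Fin.≟ y)) (shape i))

shape-aux : ∀ i → ∃ λ k → suc (suc k) ∈ shape i
shape-aux = from-yes (Fin.all? λ i → Fin.any? λ k → suc (suc k) ∈? shape i)

shape-injective : ∀ i j → (∀ t → (t ∈ shape i → t ∈ shape j) × (t ∈ shape j → t ∈ shape i)) → i ≡ j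
shape-injective = from-yes (Fin.all? λ i → Fin.all? λ j →
  (Fin.all? λ t → (t ∈? shape i →-dec t ∈? shape j) ×-dec (t ∈? shape j →-dec t ∈? shape i)) →-dec i Fin.≟ j)

module Compiled (H : Hypergraph) (P : Arrangement H) where
  open Arrangement P
  open Compilation H P using (links; #L; Vertex; copy; aux; sourceEdge; gadgetEdge)

  private H̃ = compiled H P

  first second : Fin #L → Occurrence H
  first = proj₁ ∘ List.lookup links
  second   = proj₂ ∘ List.lookup links

  ∈-path⁻ : ∀ {v o} → o List.∈ path v → vertexAt H o ≡ v
  ∈-path⁻ {v} o∈ = proj₂ (List.∈-filter⁻ (λ o → vertexAt H o Fin.≟ v)
    {xs = List.cartesianProduct (List.allFin (#E H)) (List.allFin 3)} (↭.∈-resp-↭ (path-↭ v) o∈))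

  ∈-path⁺ : ∀ o → o List.∈ path (vertexAt H o)
  ∈-path⁺ o = ↭.∈-resp-↭ (↭-sym (path-↭ (vertexAt H o)))
    (List.∈-filter⁺ (λ p → vertexAt H p Fin.≟ vertexAt H o)
      (List.∈-cartesianProduct⁺ (List.∈-allFin (proj₁ o)) (List.∈-allFin (proj₂ o))) refl)

  path-unique : ∀ v → List.Unique (path v)
  path-unique v = ↭ₛ.Unique-resp-↭ (setoid _) (↭⇒↭ₛ (↭-sym (path-↭ v)))
    (Unique.filter⁺ (λ o → vertexAt H o Fin.≟ v) (Unique.cartesianProduct⁺ (Unique.allFin⁺ (#E H)) (Unique.allFin⁺ 3)))

  All-links⁺ : ∀ {Q : Occurrence H × Occurrence H → Set} → (∀ v → All Q (consecutive (path v))) → All Q links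
  All-links⁺ h = All.concat⁺ (All.map⁺ (All.tabulate⁺ h))

  All-links⁻ : ∀ {Q : Occurrence H × Occurrence H → Set} → All Q links → ∀ v → All Q (consecutive (path v))
  All-links⁻ h = All.tabulate⁻ (All.map⁻ (All.concat⁻ h))

  ends-at : ∀ v → All (λ (x , y) → vertexAt H x ≡ v × vertexAt H y ≡ v) (consecutive (path v))
  ends-at v = All-consecutive (All.tabulate ∈-path⁻)

  same-vertex : ∀ l → vertexAt H (first l) ≡ vertexAt H (second l)
  same-vertex l = All.lookup {xs = links} (All-links⁺ λ v → All.map (λ (p , q) → trans p (sym q)) (ends-at v)) (List.∈-lookup l)

  first≢second : ∀ l → first l ≢ second l
  first≢second l = All.lookup {xs = links} (All-links⁺ (consecutive-≢ ∘ path-unique)) (List.∈-lookup l)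

  private
    -- Ends on the same path differ by assumption; ends on different paths differ because the
    -- original vertex of an occurrence determines its path.
    unique-ends : (f : Occurrence H × Occurrence H → Occurrence H) →
      (∀ v → List.Unique (List.map f (consecutive (path v)))) →
      (∀ v → All (λ l → vertexAt H (f l) ≡ v) (consecutive (path v))) →
      List.Unique (List.map f links)
    unique-ends f unique at = subst List.Unique (sym (List.map-concatMap f (consecutive ∘ path) (List.allFin (#V H))))
      (Unique.concat⁺ (All.map⁺ (All.tabulate⁺ unique)) (AllPairs.map⁺ (AllPairs.tabulate⁺ λ u≢v (o∈u , o∈v) →
        u≢v (trans (sym (vertex o∈u)) (vertex o∈v)))))
      where
      vertex : ∀ {v o} → o List.∈ List.map f (consecutive (path v)) → vertexAt H o ≡ v
      vertex {v} o∈ with List.∈-map⁻ f o∈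
      ... | l , l∈ , refl = All.lookup (at v) l∈

  first-injective : ∀ {l m} → first l ≡ first m → l ≡ m
  first-injective = lookup-map-injective {xs = links}
    (unique-ends proj₁ (unique-consecutive₁ ∘ path-unique) (All.map proj₁ ∘ ends-at)) _ _

  second-injective : ∀ {l m} → second l ≡ second m → l ≡ m
  second-injective = lookup-map-injective {xs = links} (unique-ends proj₂
    (λ v → subst List.Unique (sym (map-proj₂-consecutive (path v))) (Unique.drop⁺ 1 (path-unique v)))
    (All.map proj₂ ∘ ends-at)) _ _

  copy-injective : ∀ {o p} → copy o ≡ copy p → o ≡ p
  copy-injective {e , j} {f , k} eq with Fin.combine-injective e j f k (Fin.↑ˡ-injective (#L ℕ.* 3) _ _ eq)
  ... | refl , refl = refl

  aux-injective : ∀ {l k m n} → aux l k ≡ aux m n → l ≡ m × k ≡ n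
  aux-injective {l} {k} {m} {n} eq = Fin.combine-injective l k m n (Fin.↑ʳ-injective (#E H ℕ.* 3) _ _ eq)

  copy≢aux : ∀ {o l k} → copy o ≢ aux l k
  copy≢aux {o} {l} {k} eq with
    trans (sym (Fin.splitAt-↑ˡ (#E H ℕ.* 3) (uncurry combine o) (#L ℕ.* 3)))
      (trans (cong (splitAt (#E H ℕ.* 3)) eq) (Fin.splitAt-↑ʳ (#E H ℕ.* 3) (#L ℕ.* 3) (combine l k)))
  ... | ()

  -- Every link is charged to its first occurrence. This keeps the gadgets, and so the running time,
  -- linear in the size of `H`.
  #L≤ : #L ℕ.≤ #E H ℕ.* 3
  #L≤ = Fin.injective⇒≤ {f = uncurry combine ∘ first} λ {l} {m} eq →
    first-injective (copy-injective (cong (_↑ˡ (#L ℕ.* 3)) eq))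

  -- Names the five variables of the abstract gadget in a given link. As the naming is injective,
  -- facts decided once for `shape` transfer to all links.
  slot : Fin #L → Fin 5 → Vertex
  slot l 0F            = copy (first l)
  slot l 1F            = copy (second l)
  slot l (suc (suc k)) = aux l k

  gadgetEdge≡ : ∀ l i → gadgetEdge l i ≡ Vec.map (slot l) (shape i)
  gadgetEdge≡ l 0F = refl
  gadgetEdge≡ l 1F = refl
  gadgetEdge≡ l 2F = refl
  gadgetEdge≡ l 3F = refl
  gadgetEdge≡ l 4F = refl
  gadgetEdge≡ l 5F = refl

  slot-injective : ∀ l {s t} → slot l s ≡ slot l t → s ≡ t
  slot-injective l {0F}          {0F}          _  = refl
  slot-injective l {0F}          {1F}          eq = contradiction (copy-injective eq) (first≢second l)
  slot-injective l {0F}          {suc (suc _)} eq = contradiction eq copy≢aux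
  slot-injective l {1F}          {0F}          eq = contradiction (sym (copy-injective eq)) (first≢second l)
  slot-injective l {1F}          {1F}          _  = refl
  slot-injective l {1F}          {suc (suc _)} eq = contradiction eq copy≢aux
  slot-injective l {suc (suc _)} {0F}          eq = contradiction (sym eq) copy≢aux
  slot-injective l {suc (suc _)} {1F}          eq = contradiction (sym eq) copy≢aux
  slot-injective l {suc (suc _)} {suc (suc _)} eq = cong (suc ∘ suc) (proj₂ (aux-injective eq))

  aux≡slot⇒≡ : ∀ {l k m} t → aux l k ≡ slot m t → l ≡ m
  aux≡slot⇒≡ 0F            eq = contradiction (sym eq) copy≢aux
  aux≡slot⇒≡ 1F            eq = contradiction (sym eq) copy≢aux
  aux≡slot⇒≡ (suc (suc _)) eq = proj₁ (aux-injective eq)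

  sourceIndex : Fin (#E H) → Fin (#E H̃)
  sourceIndex e = e ↑ˡ (#L ℕ.* 6)

  gadgetIndex : Fin #L → Fin 6 → Fin (#E H̃)
  gadgetIndex l i = #E H ↑ʳ combine l i

  edge-shape : ∀ l i → edge H̃ (gadgetIndex l i) ≡ Vec.map (slot l) (shape i)
  edge-shape l i = trans (edge-gadget H P l i) (gadgetEdge≡ l i)

  data EdgeView : Fin (#E H̃) → Set where
    source : ∀ e → EdgeView (sourceIndex e)
    gadget : ∀ l i → EdgeView (gadgetIndex l i)

  edgeView : ∀ e → EdgeView e
  edgeView e with splitAt (#E H) e in eq
  ... | inj₁ f = subst EdgeView (Fin.splitAt⁻¹-↑ˡ eq) (source f)
  ... | inj₂ i = subst EdgeView (trans (cong (#E H ↑ʳ_) (Fin.combine-remQuot {#L} 6 i)) (Fin.splitAt⁻¹-↑ʳ eq))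
                   (uncurry gadget (remQuot 6 i))

  all-edges : ∀ {Q : Vec Vertex 3 → Set} → (∀ e → Q (sourceEdge e)) → (∀ l i → Q (Vec.map (slot l) (shape i))) →
              ∀ e → Q (edge H̃ e)
  all-edges {Q} src gad e with edgeView e
  ... | source f   = subst Q (sym (edge-source H P f)) (src f)
  ... | gadget l i = subst Q (sym (edge-shape l i)) (gad l i)

  ∈-source⁻ : ∀ {v e} → v ∈ edge H̃ (sourceIndex e) → ∃ λ j → v ≡ copy (e , j)
  ∈-source⁻ {v} {e} v∈ = VecAny.tabulate⁻ (subst (v ∈_) (edge-source H P e) v∈)

  ∈-source⁺ : ∀ e j → copy (e , j) ∈ edge H̃ (sourceIndex e)
  ∈-source⁺ e j = subst (copy (e , j) ∈_) (sym (edge-source H P e)) (Vec.∈-tabulate⁺ (λ k → copy (e , k)) j)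

  ∈-gadget⁻ : ∀ {v l i} → v ∈ edge H̃ (gadgetIndex l i) → ∃ λ t → v ≡ slot l t × t ∈ shape i
  ∈-gadget⁻ {v} {l} {i} v∈ with find (VecAny.map⁻ (subst (v ∈_) (edge-shape l i) v∈))
  ... | t , t∈ , eq = t , eq , t∈

  ∈-gadget⁺ : ∀ l i {t} → t ∈ shape i → slot l t ∈ edge H̃ (gadgetIndex l i)
  ∈-gadget⁺ l i {t} t∈ = subst (slot l t ∈_) (sym (edge-shape l i)) (Vec.∈-map⁺ (slot l) t∈)

  ∈-gadget-slot⁻ : ∀ l i t → slot l t ∈ edge H̃ (gadgetIndex l i) → t ∈ shape i
  ∈-gadget-slot⁻ l i t v∈ with ∈-gadget⁻ {l = l} v∈
  ... | s , eq , s∈ = subst (_∈ shape i) (sym (slot-injective l eq)) s∈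

  compiled-uniform : ThreeUniform H̃
  compiled-uniform = all-edges {Unique}
    (λ e → VecUnique.tabulate⁺ {f = λ j → copy (e , j)} (λ eq → cong proj₂ (copy-injective eq)))
    (λ l i → VecUnique.map⁺ (slot-injective l) (shape-unique i))

  -- A copy records the hyperedge it comes from, so any one vertex of a source hyperedge identifies
  -- it. Every gadget hyperedge contains an auxiliary vertex, which separates it from the source
  -- hyperedges and identifies its link; inside one gadget `shape-injective` decides.
  compiled-simple : Simple H̃
  compiled-simple e f same with edgeView e | edgeView f
  ... | source e | source f with ∈-source⁻ (Equivalence.to (same (copy (e , 0F))) (∈-source⁺ e 0F))
  ...   | _ , eq = cong (sourceIndex ∘ proj₁) (copy-injective eq)
  compiled-simple _ _ same | source e | gadget l i with shape-aux i
  ... | k , k∈ = contradiction (sym (proj₂ (∈-source⁻ (Equivalence.from (same (aux l k)) (∈-gadget⁺ l i k∈))))) copy≢aux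
  compiled-simple _ _ same | gadget l i | source e with shape-aux i
  ... | k , k∈ = contradiction (sym (proj₂ (∈-source⁻ (Equivalence.to (same (aux l k)) (∈-gadget⁺ l i k∈))))) copy≢aux
  compiled-simple _ _ same | gadget l i | gadget m j with shape-aux i
  ... | k , k∈ with ∈-gadget⁻ {l = m} (Equivalence.to (same (aux l k)) (∈-gadget⁺ l i k∈))
  ...   | t , eq , _ with aux≡slot⇒≡ t eq
  ...     | refl = cong (gadgetIndex l) (shape-injective i j λ t →
                (λ t∈ → ∈-gadget-slot⁻ l j t (Equivalence.to (same (slot l t)) (∈-gadget⁺ l i t∈)))
              , (λ t∈ → ∈-gadget-slot⁻ l i t (Equivalence.from (same (slot l t)) (∈-gadget⁺ l j t∈))))

  gadgetDegree : Vertex → Fin #L → ℕ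
  gadgetDegree v l = Σℕ λ i → indicator (v ∈? edge H̃ (gadgetIndex l i))

  degree≡ : ∀ v → degree H̃ v ≡ Σℕ (λ e → indicator (v ∈? edge H̃ (sourceIndex e))) ℕ.+ Σℕ (gadgetDegree v)
  degree≡ v = trans (length-filter-tabulate (λ e → v ∈? edge H̃ e) id)
    (trans (Σℕ-↑ (#E H) _) (cong (Σℕ (λ e → indicator (v ∈? edge H̃ (sourceIndex e))) ℕ.+_) (Σℕ-combine #L _)))

  gadgetDegree-slot : ∀ l t → gadgetDegree (slot l t) l ≡ Σℕ λ i → indicator (t ∈? shape i)
  gadgetDegree-slot l t = Σℕ-cong λ i → indicator-⇔ (slot l t ∈? edge H̃ (gadgetIndex l i)) (t ∈? shape i)
    (mk⇔ (∈-gadget-slot⁻ l i t) (∈-gadget⁺ l i))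

  gadgetDegree-none : ∀ {v l} → (∀ t → v ≢ slot l t) → gadgetDegree v l ≡ 0
  gadgetDegree-none {v} {l} v∉ = Σℕ-zero λ i → indicator-false (v ∈? edge H̃ (gadgetIndex l i))
    λ v∈ → let (t , eq , _) = ∈-gadget⁻ {l = l} v∈ in v∉ t eq

  -- 7 = 1 + 3 + 3: one source hyperedge, and three gadget hyperedges for each of the at most two
  -- links that the copy starts or finishes.
  degree-copy : ∀ o → degree H̃ (copy o) ℕ.≤ 7
  degree-copy o = begin
    degree H̃ (copy o)
      ≡⟨ degree≡ (copy o) ⟩
    Σℕ (λ e → indicator (copy o ∈? edge H̃ (sourceIndex e))) ℕ.+ Σℕ (gadgetDegree (copy o))
      ≤⟨ ℕ.+-mono-≤ (Σℕ-indicator-≤1 (λ e → copy o ∈? edge H̃ (sourceIndex e)) λ p q → trans (sym (edge-of p)) (edge-of q))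
           (Σℕ-mono gadgetDegree≤) ⟩
    1 ℕ.+ Σℕ (λ l → 3 ℕ.* indicator (starts l) ℕ.+ 3 ℕ.* indicator (finishes l))
      ≡⟨ cong ℕ.suc (trans (Σℕ-distrib-+ (λ l → 3 ℕ.* indicator (starts l)) _)
           (sym (cong₂ ℕ._+_ (*-distribˡ-Σℕ 3 (indicator ∘ starts)) (*-distribˡ-Σℕ 3 (indicator ∘ finishes))))) ⟩
    1 ℕ.+ (3 ℕ.* Σℕ (indicator ∘ starts) ℕ.+ 3 ℕ.* Σℕ (indicator ∘ finishes))
      ≤⟨ ℕ.+-monoʳ-≤ 1 (ℕ.+-mono-≤
           (ℕ.*-monoʳ-≤ 3 (Σℕ-indicator-≤1 starts λ p q → first-injective (trans p (sym q))))
           (ℕ.*-monoʳ-≤ 3 (Σℕ-indicator-≤1 finishes λ p q → second-injective (trans p (sym q))))) ⟩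
    7 ∎
    where
    open ℕ.≤-Reasoning
    _≟ₒ_ : (p q : Occurrence H) → Dec (p ≡ q)
    _≟ₒ_ = ≡-dec Fin._≟_ Fin._≟_
    starts : ∀ l → Dec (first l ≡ o)
    starts l = first l ≟ₒ o
    finishes : ∀ l → Dec (second l ≡ o)
    finishes l = second l ≟ₒ o
    edge-of : ∀ {e} → copy o ∈ edge H̃ (sourceIndex e) → proj₁ o ≡ e
    edge-of v∈ = cong proj₁ (copy-injective (proj₂ (∈-source⁻ v∈)))
    gadgetDegree≤ : ∀ l → gadgetDegree (copy o) l ℕ.≤ 3 ℕ.* indicator (starts l) ℕ.+ 3 ℕ.* indicator (finishes l)
    gadgetDegree≤ l with starts l | finishes l
    ... | yes refl | fin      = ℕ.≤-trans (ℕ.≤-reflexive (gadgetDegree-slot l 0F)) (ℕ.m≤m+n 3 _)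
    ... | no _     | yes refl = ℕ.≤-reflexive (gadgetDegree-slot l 1F)
    ... | no o≢    | no o≢′   = ℕ.≤-reflexive (gadgetDegree-none {l = l} λ where
      0F            eq → o≢ (sym (copy-injective eq))
      1F            eq → o≢′ (sym (copy-injective eq))
      (suc (suc _)) eq → copy≢aux eq)

  -- Two of the three pairs from `a`, `b`, `c` contain a given one of them, and each pair occurs
  -- with both terminals.
  degree-aux : ∀ l k → degree H̃ (aux l k) ≡ 4
  degree-aux l k = begin
    degree H̃ (aux l k)
      ≡⟨ degree≡ (aux l k) ⟩
    Σℕ (λ e → indicator (aux l k ∈? edge H̃ (sourceIndex e))) ℕ.+ Σℕ (gadgetDegree (aux l k))
      ≡⟨ cong₂ ℕ._+_ (Σℕ-zero λ e → indicator-false (aux l k ∈? edge H̃ (sourceIndex e)) λ v∈ →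
           copy≢aux (sym (proj₂ (∈-source⁻ v∈)))) (Σℕ-cong gadgetDegree-aux) ⟩
    Σℕ (λ m → 4 ℕ.* indicator (m Fin.≟ l))
      ≡⟨ sym (*-distribˡ-Σℕ 4 (λ m → indicator (m Fin.≟ l))) ⟩
    4 ℕ.* Σℕ (λ m → indicator (m Fin.≟ l))
      ≡⟨ cong (4 ℕ.*_) (Σℕ-indicator-≡ l) ⟩
    4 ∎
    where
    open ≡-Reasoning
    four : ∀ k → Σℕ (λ i → indicator (suc (suc k) ∈? shape i)) ≡ 4
    four 0F = refl
    four 1F = refl
    four 2F = refl
    gadgetDegree-aux : ∀ m → gadgetDegree (aux l k) m ≡ 4 ℕ.* indicator (m Fin.≟ l)
    gadgetDegree-aux m with m Fin.≟ l
    ... | yes refl = trans (gadgetDegree-slot l (suc (suc k))) (four k)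
    ... | no m≢l   = gadgetDegree-none {l = m} λ t eq → m≢l (sym (aux≡slot⇒≡ t eq))

-- Descending and lifting mixtures

gadget-equal : ∀ (χ : Fin 5 → Fin 2) → (∀ i → NAE₃ (Vec.map χ (shape i))) → χ 0F ≡ χ 1F
-- The decision procedure runs over five single colours, so `χ` is replaced by the vector of its
-- values, with which it agrees pointwise.
gadget-equal χ nae = verified (χ 0F) (χ 1F) (χ 2F) (χ 3F) (χ 4F) λ i → subst NAE₃ (Vec.map-cong agree (shape i)) (nae i)
  where
  verified : ∀ x y a b c → (∀ i → NAE₃ (Vec.map (Vec.lookup (x ∷ y ∷ a ∷ b ∷ c ∷ [])) (shape i))) → x ≡ y
  verified = from-yes (Fin.all? λ x → Fin.all? λ y → Fin.all? λ a → Fin.all? λ b → Fin.all? λ c →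
    (Fin.all? λ i → NAE₃? (Vec.map (Vec.lookup (x ∷ y ∷ a ∷ b ∷ c ∷ [])) (shape i))) →-dec x Fin.≟ y)
  agree : ∀ t → χ t ≡ Vec.lookup (χ 0F ∷ χ 1F ∷ χ 2F ∷ χ 3F ∷ χ 4F ∷ []) t
  agree 0F = refl
  agree 1F = refl
  agree 2F = refl
  agree 3F = refl
  agree 4F = refl

paint : Fin 2 → Fin 3 → Fin 5 → Fin 2
paint s k 0F            = s
paint s k 1F            = s
paint s k (suc (suc j)) = if does (j Fin.≟ k) then s else opposite s

paint-nae : ∀ s k i → NAE₃ (Vec.map (paint s k) (shape i))
paint-nae = from-yes (Fin.all? λ s → Fin.all? λ k → Fin.all? λ i → NAE₃? (Vec.map (paint s k) (shape i)))

⅓ : ℚ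
⅓ = ℤ.+ 1 / 3

average : (Fin 3 → ℚ) → ℚ
average f = ⅓ ℚ.* (f 0F ℚ.+ (f 1F ℚ.+ f 2F))

-- Averaged over k, the marginal on each gadget hyperedge is uniform on the NAE tuples
-- compatible with s.
paint-average : ∀ s i u →
  average (λ k → 𝟙 (Vec.map (paint s k) (shape i) ≟ᵒ u)) ℚ.≤
  mass uniformNAE u ℚ.* (𝟙 (s Fin.≟ Vec.head u) ℚ.+ 𝟙 (s Fin.≟ Vec.head u))
paint-average s i (x ∷ y ∷ z ∷ []) = verified s i x y z
  where
  verified : ∀ s i x y z → _
  verified = from-yes (Fin.all? λ s → Fin.all? λ i → Fin.all? λ x → Fin.all? λ y → Fin.all? λ z →
    average (λ k → 𝟙 (Vec.map (paint s k) (shape i) ≟ᵒ x ∷ y ∷ z ∷ [])) ℚ.≤?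
    mass uniformNAE (x ∷ y ∷ z ∷ []) ℚ.* (𝟙 (s Fin.≟ x) ℚ.+ 𝟙 (s Fin.≟ x)))

average-const : ∀ q → average (λ _ → q) ≡ q
average-const q = trans (solve 2 (λ c q → c :* (q :+ (q :+ q)) := (c :+ (c :+ c)) :* q) refl ⅓ q) (ℚ.*-identityˡ q)
  where open +-*-Solver using (solve; _:=_; _:+_; _:*_)

module _ {A B : Set} where
  -- The image under `h` of the product of the mixture with the uniform distribution on `Fin 3`.
  spread : (Fin 3 → A → B) → Weighted A → Weighted B
  spread h []             = []
  spread h ((w , x) ∷ xs) = (w ℚ.* ⅓ , h 0F x) ∷ (w ℚ.* ⅓ , h 1F x) ∷ (w ℚ.* ⅓ , h 2F x) ∷ spread h xs

  spread≥0 : ∀ {h} {xs} → NonNegWeights xs → NonNegWeights (spread h xs)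
  spread≥0 []         = []
  spread≥0 {xs = (w , _) ∷ _} (w≥0 ∷ ws) = third ∷ third ∷ third ∷ spread≥0 ws
    where
    third : 0ℚ ℚ.≤ w ℚ.* ⅓
    third = subst (ℚ._≤ w ℚ.* ⅓) (ℚ.*-zeroˡ ⅓) (ℚ.*-monoʳ-≤-nonNeg ⅓ w≥0)

  ∫-spread : ∀ (f : B → ℚ) h xs → ∫ f (spread h xs) ≡ ∫ (λ x → average λ k → f (h k x)) xs
  ∫-spread f h []             = refl
  ∫-spread f h ((w , x) ∷ xs) rewrite ∫-spread f h xs =
    solve 6 (λ w t a b c r → w :* t :* a :+ (w :* t :* b :+ (w :* t :* c :+ r)) := w :* (t :* (a :+ (b :+ c))) :+ r)
      refl w ⅓ (f (h 0F x)) (f (h 1F x)) (f (h 2F x)) (∫ (λ x → average λ k → f (h k x)) xs)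
    where open +-*-Solver using (solve; _:=_; _:+_; _:*_)

module Mixtures (H : Hypergraph) (P : Arrangement H) where
  open Arrangement P
  open Compilation H P using (links; #L; Vertex; copy; sourceEdge)
  open Compiled H P

  private H̃ = compiled H P

  map-source : ∀ (χ : Vertex → Fin 2) e → Vec.map χ (sourceEdge e) ≡ Vec.tabulate (λ j → χ (copy (e , j)))
  map-source χ e = sym (Vec.tabulate-∘ χ (λ j → copy (e , j)))

  -- Each gadget carries equality across one link, and the path of a vertex runs through all of its
  -- occurrences.
  copies-agree : ∀ χ → NAEColouring H̃ χ → ∀ {o p} → vertexAt H o ≡ vertexAt H p → χ (copy o) ≡ χ (copy p)
  copies-agree χ nae {o} {p} eq = constant-along (χ ∘ copy) (All-links⁻ linked (vertexAt H p))
    (subst (λ v → o List.∈ path v) eq (∈-path⁺ o)) (∈-path⁺ p)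
    where
    linked : All (λ (x , y) → χ (copy x) ≡ χ (copy y)) links
    linked = subst (All _) (List.tabulate-lookup links) (All.tabulate⁺ λ l →
      gadget-equal (χ ∘ slot l) λ i → subst NAE₃
        (trans (cong (Vec.map χ) (edge-shape l i)) (sym (Vec.map-∘ χ (slot l) (shape i)))) (nae (gadgetIndex l i)))

  mixture-descends : NoIsolated H → ∀ {q} → Mixture H̃ q → Mixture H q
  mixture-descends ni mixture = record
    { terms    = List.map (map₂ contract) terms
    ; weight≥0 = All.map⁺ weight≥0
    ; bound    = λ e u → ℚ.≤-trans
        (ℚ.≤-reflexive (∫-map _ contract terms))
        (ℚ.≤-trans (∫-mono weight≥0 (All.map (λ {(_ , χ)} nae w≢0 →
            ℚ.≤-reflexive (cong (λ v → 𝟙 (v ≟ᵒ u)) (contract-edge χ (nae w≢0) e))) nae-on-support))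
          (bound (sourceIndex e) u))
    ; ∫1≡      = trans (∫-map _ contract terms) ∫1≡
    }
    where
    open Mixture mixture
    -- Any choice of a representative copy works: at nonzero weight all copies of a vertex have the
    -- same colour by `copies-agree`.
    occurrence : Fin (#V H) → Occurrence H
    occurrence v = let (e , v∈) = ni v in e , VecAny.index v∈
    vertex-occurrence : ∀ v → v ≡ vertexAt H (occurrence v)
    vertex-occurrence v = VecAny.lookup-index (proj₂ (ni v))
    contract : Colouring H̃ → Colouring H
    contract χ v = χ (copy (occurrence v))
    contract-edge : ∀ χ → NAEColouring H̃ χ → ∀ e → Vec.map (contract χ) (edge H e) ≡ Vec.map χ (edge H̃ (sourceIndex e))
    contract-edge χ nae e = begin
      Vec.map (contract χ) (edge H e)                           ≡⟨ map≡tabulate (contract χ) (edge H e) ⟩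
      Vec.tabulate (λ j → contract χ (vertexAt H (e , j)))      ≡⟨ Vec.tabulate-cong (λ j → copies-agree χ nae (sym (vertex-occurrence (vertexAt H (e , j))))) ⟩
      Vec.tabulate (λ j → χ (copy (e , j)))                     ≡⟨ map-source χ e ⟨
      Vec.map χ (sourceEdge e)                                  ≡⟨ cong (Vec.map χ) (edge-source H P e) ⟨
      Vec.map χ (edge H̃ (sourceIndex e)) ∎
      where open ≡-Reasoning

  -- One `k` serves all links at once. The gadgets become correlated, but every bound of a mixture
  -- concerns a single hyperedge.
  expand : Fin 3 → Colouring H → Colouring H̃
  expand k χ = [ χ ∘ vertexAt H ∘ remQuot 3 , uncurry auxColour ∘ remQuot 3 ]′ ∘ splitAt (#E H ℕ.* 3)
    where
    auxColour : Fin #L → Fin 3 → Fin 2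
    auxColour l j = paint (χ (vertexAt H (first l))) k (suc (suc j))

  expand-copy : ∀ k χ o → expand k χ (copy o) ≡ χ (vertexAt H o)
  expand-copy k χ (e , j) = trans (cong [ _ , _ ]′ (Fin.splitAt-↑ˡ (#E H ℕ.* 3) (combine e j) (#L ℕ.* 3)))
    (cong (χ ∘ vertexAt H) (Fin.remQuot-combine e j))

  expand-slot : ∀ k χ l t → expand k χ (slot l t) ≡ paint (χ (vertexAt H (first l))) k t
  expand-slot k χ l 0F            = expand-copy k χ (first l)
  expand-slot k χ l 1F            = trans (expand-copy k χ (second l)) (cong χ (sym (same-vertex l)))
  expand-slot k χ l (suc (suc j)) =
    trans (cong [ χ ∘ vertexAt H ∘ remQuot 3 , _ ]′ (Fin.splitAt-↑ʳ (#E H ℕ.* 3) (#L ℕ.* 3) (combine l j)))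
      (cong (uncurry λ l j → paint (χ (vertexAt H (first l))) k (suc (suc j))) (Fin.remQuot-combine l j))

  expand-source : ∀ k χ e → Vec.map (expand k χ) (sourceEdge e) ≡ Vec.map χ (edge H e)
  expand-source k χ e = trans (map-source (expand k χ) e)
    (trans (Vec.tabulate-cong λ j → expand-copy k χ (e , j)) (sym (map≡tabulate χ (edge H e))))

  expand-gadget : ∀ k χ l i → Vec.map (expand k χ) (Vec.map (slot l) (shape i)) ≡ Vec.map (paint (χ (vertexAt H (first l))) k) (shape i)
  expand-gadget k χ l i = trans (sym (Vec.map-∘ (expand k χ) (slot l) (shape i))) (Vec.map-cong (expand-slot k χ l) (shape i))

  expand-nae : ∀ k χ → NAEColouring H χ → NAEColouring H̃ (expand k χ)
  expand-nae k χ nae = all-edges {λ vs → NAE₃ (Vec.map (expand k χ) vs)}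
    (λ e → subst NAE₃ (sym (expand-source k χ e)) (nae e))
    (λ l i → subst NAE₃ (sym (expand-gadget k χ l i)) (paint-nae _ k i))

  mixture-lifts : ∀ {q} → Mixture H q → Mixture H̃ q
  mixture-lifts mixture = record
    { terms    = spread expand terms
    ; weight≥0 = spread≥0 weight≥0
    ; bound    = all-edges {λ vs → ∀ u → ∫ (λ χ → 𝟙 (Vec.map χ vs ≟ᵒ u)) (spread expand terms) ℚ.≤ mass uniformNAE u} source≤ gadget≤
    ; ∫1≡      = trans (∫-spread (λ _ → 1ℚ) expand terms) ∫1≡
    }
    where
    open Mixture mixture
    open ℚ.≤-Reasoning
    source≤ : ∀ e u → ∫ (λ χ → 𝟙 (Vec.map χ (sourceEdge e) ≟ᵒ u)) (spread expand terms) ℚ.≤ mass uniformNAE u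
    source≤ e u = begin
      ∫ (λ χ → 𝟙 (Vec.map χ (sourceEdge e) ≟ᵒ u)) (spread expand terms)
        ≡⟨ ∫-spread _ expand terms ⟩
      ∫ (λ χ → average λ k → 𝟙 (Vec.map (expand k χ) (sourceEdge e) ≟ᵒ u)) terms
        ≤⟨ ∫-mono′ weight≥0 (λ χ → ℚ.≤-reflexive (trans
             (average-cong λ k → cong (λ v → 𝟙 (v ≟ᵒ u)) (expand-source k χ e)) (average-const _))) ⟩
      ∫ (λ χ → 𝟙 (Vec.map χ (edge H e) ≟ᵒ u)) terms
        ≤⟨ bound e u ⟩
      mass uniformNAE u ∎
      where
      average-cong : ∀ {f g} → (∀ k → f k ≡ g k) → average f ≡ average g
      average-cong h = cong (⅓ ℚ.*_) (cong₂ ℚ._+_ (h 0F) (cong₂ ℚ._+_ (h 1F) (h 2F)))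
    gadget≤ : ∀ l i u → ∫ (λ χ → 𝟙 (Vec.map χ (Vec.map (slot l) (shape i)) ≟ᵒ u)) (spread expand terms) ℚ.≤ mass uniformNAE u
    gadget≤ l i u = begin
      ∫ (λ χ → 𝟙 (Vec.map χ (Vec.map (slot l) (shape i)) ≟ᵒ u)) (spread expand terms)
        ≡⟨ ∫-spread _ expand terms ⟩
      ∫ (λ χ → average λ k → 𝟙 (Vec.map (expand k χ) (Vec.map (slot l) (shape i)) ≟ᵒ u)) terms
        ≤⟨ ∫-mono′ weight≥0 (λ χ → ℚ.≤-trans
             (ℚ.≤-reflexive (cong (⅓ ℚ.*_) (cong₂ ℚ._+_ (step χ 0F) (cong₂ ℚ._+_ (step χ 1F) (step χ 2F)))))
             (paint-average (χ (vertexAt H (first l))) i u)) ⟩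
      ∫ (λ χ → m ℚ.* (δ χ ℚ.+ δ χ)) terms
        ≡⟨ trans (∫-* m _ terms) (cong (m ℚ.*_) (∫-+ δ δ terms)) ⟩
      m ℚ.* (∫ δ terms ℚ.+ ∫ δ terms)
        -- Each of the two integrals is at most 1/2, so the bracket is at most 1. The indicator is
        -- doubled in `paint-average` for this purpose: 1/3 is written there as twice the mass 1/6.
        ≤⟨ ℚ.*-monoˡ-≤-nonNeg m ⦃ ℚ.nonNegative (mass≥0 uniformNAE u) ⦄
             (ℚ.+-mono-≤ (half (first l) (Vec.head u)) (half (first l) (Vec.head u))) ⟩
      m ℚ.* 1ℚ
        ≡⟨ ℚ.*-identityʳ m ⟩
      m ∎
      where
      m = mass uniformNAE u
      δ : Colouring H → ℚ
      δ χ = 𝟙 (χ (vertexAt H (first l)) Fin.≟ Vec.head u)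
      step : ∀ χ k → 𝟙 (Vec.map (expand k χ) (Vec.map (slot l) (shape i)) ≟ᵒ u) ≡ 𝟙 (Vec.map (paint (χ (vertexAt H (first l))) k) (shape i) ≟ᵒ u)
      step χ k = cong (λ v → 𝟙 (v ≟ᵒ u)) (expand-gadget k χ l i)

  NCF-compiled : (ni : NoIsolated H) (nz : NonZero (#E H)) →
    NCF (naeModel H̃ (compiled-noIsolated H P) (compiled-nonZero H P nz)) ≡ NCF (naeModel H ni nz)
  NCF-compiled ni nz = ℚ.≤-antisym
    (mixture≤NCF H ni nz (mixture-descends ni (NCF-mixture H̃ (compiled-noIsolated H P) (compiled-nonZero H P nz))))
    (mixture≤NCF H̃ (compiled-noIsolated H P) (compiled-nonZero H P nz) (mixture-lifts (NCF-mixture H ni nz)))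

-- The colouring program

module _ {A B : Set} (f : A → B) (c : B) where
  map≡replicate⇒All : ∀ {n} (xs : Vec A n) → Vec.map f xs ≡ Vec.replicate n c → VecAll (λ x → f x ≡ c) xs
  map≡replicate⇒All []       _  = []
  map≡replicate⇒All (x ∷ xs) eq = Vec.∷-injectiveˡ eq ∷ map≡replicate⇒All xs (Vec.∷-injectiveʳ eq)

  All⇒map≡replicate : ∀ {n} {xs : Vec A n} → VecAll (λ x → f x ≡ c) xs → Vec.map f xs ≡ Vec.replicate n c
  All⇒map≡replicate []       = refl
  All⇒map≡replicate (p ∷ ps) = cong₂ _∷_ p (All⇒map≡replicate ps)

module _ {H : Hypergraph} {χ : Colouring H} where
  proper⇒nae : Proper H χ → NAEColouring H χ
  proper⇒nae proper e = (λ eq → proper e (0F , map≡replicate⇒All χ 0F (edge H e) eq))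
                      , (λ eq → proper e (1F , map≡replicate⇒All χ 1F (edge H e) eq))

  nae⇒proper : NAEColouring H χ → Proper H χ
  nae⇒proper nae e (0F , all) = proj₁ (nae e) (All⇒map≡replicate χ 0F all)
  nae⇒proper nae e (1F , all) = proj₂ (nae e) (All⇒map≡replicate χ 1F all)

-- Array contents as lists

module _ {A : Set} (f : ℕ → A) (x : A) where
  ↦-same : ∀ {i j} → j ≡ i → (f [ i ↦ x ]) j ≡ x
  ↦-same {i} {j} j≡i = cong (if_then x else f j) (dec-true (j ℕ.≟ i) j≡i)

  ↦-other : ∀ {i j} → j ≢ i → (f [ i ↦ x ]) j ≡ f j
  ↦-other {i} {j} j≢i = cong (if_then x else f j) (dec-false (j ℕ.≟ i) j≢i)

cells-toℕ : ∀ {n} (f : Fin n → ℕ) i → cells f (toℕ i) ≡ f i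
cells-toℕ f zero    = refl
cells-toℕ f (suc i) = cells-toℕ (f ∘ suc) i

-- Cells past the end read 0, as in the initial state, so an array can be equated with a list at
-- every index and appending is a single write.
contents : List ℕ → ℕ → ℕ
contents xs = cells (List.lookup xs)

contents-∷ʳ : ∀ xs x i → (if i ℕ.≡ᵇ List.length xs then x else contents xs i) ≡ contents (xs ∷ʳ x) i
contents-∷ʳ []       x ℕ.zero    = refl
contents-∷ʳ []       x (ℕ.suc i) = refl
contents-∷ʳ (y ∷ xs) x ℕ.zero    = refl
contents-∷ʳ (y ∷ xs) x (ℕ.suc i) = contents-∷ʳ xs x i

contents-++ʳ : ∀ xs ys i → contents (xs ++ ys) (List.length xs ℕ.+ i) ≡ contents ys i
contents-++ʳ []       ys i = refl
contents-++ʳ (x ∷ xs) ys i = contents-++ʳ xs ys i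

contents-toList : ∀ {n} (xs : Vec ℕ n) ys j → contents (Vec.toList xs ++ ys) (toℕ j) ≡ Vec.lookup xs j
contents-toList (x ∷ xs) ys zero    = refl
contents-toList (x ∷ xs) ys (suc j) = contents-toList xs ys j

contents-blocks : ∀ {A : Set} {n} (block : A → Vec ℕ 3) (f : Fin n → A) ys i j →
  contents (List.concatMap (Vec.toList ∘ block) (List.tabulate f) ++ ys) (toℕ (combine i j)) ≡ Vec.lookup (block (f i)) j
contents-blocks {n = ℕ.suc n} block f ys zero j = begin
  contents ((Vec.toList (block (f zero)) ++ rest) ++ ys) (toℕ (j ↑ˡ (n ℕ.* 3)))
    ≡⟨ cong₂ contents (List.++-assoc (Vec.toList (block (f zero))) rest ys) (Fin.toℕ-↑ˡ j (n ℕ.* 3)) ⟩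
  contents (Vec.toList (block (f zero)) ++ (rest ++ ys)) (toℕ j)
    ≡⟨ contents-toList (block (f zero)) (rest ++ ys) j ⟩
  Vec.lookup (block (f zero)) j ∎
  where
  open ≡-Reasoning
  rest = List.concatMap (Vec.toList ∘ block) (List.tabulate (f ∘ suc))
-- `combine (suc i) j` is `3 ↑ʳ combine i j`; with the block split into three entries both sides
-- compute past it.
contents-blocks block f ys (suc i) j with block (f zero)
... | _ ∷ _ ∷ _ ∷ [] = contents-blocks block (f ∘ suc) ys i j

length-filter-∷ʳ : ∀ {A : Set} {P : A → Set} (P? : ∀ x → Dec (P x)) xs x →
  List.length (List.filter P? (xs ∷ʳ x)) ≡ List.length (List.filter P? xs) ℕ.+ indicator (P? x)
length-filter-∷ʳ P? xs x = trans (cong List.length (List.filter-++ P? xs (x ∷ [])))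
  (trans (List.length-++ (List.filter P? xs)) (cong (List.length (List.filter P? xs) ℕ.+_) last))
  where
  last : List.length (List.filter P? (x ∷ [])) ≡ indicator (P? x)
  last with does (P? x)
  ... | true  = refl
  ... | false = refl

length-∷ʳ : ∀ {A : Set} (xs : List A) x → List.length (xs ∷ʳ x) ≡ ℕ.suc (List.length xs)
length-∷ʳ xs x = trans (List.length-++ xs) (ℕ.+-comm _ 1)

record Written (ws : List ℕ) (s : State) : Set where
  field
    position : regs s 2 ≡ List.length ws
    written  : ∀ i → arrs s 2 i ≡ contents ws i

  append : ∀ x i → (arrs s 2 [ regs s 2 ↦ x ]) i ≡ contents (ws ∷ʳ x) i
  append x i = trans (cong₂ (λ p a → if i ℕ.≡ᵇ p then x else a) position (written i)) (contents-∷ʳ ws x i)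

  advance : ∀ x → ℕ.suc (regs s 2) ≡ List.length (ws ∷ʳ x)
  advance x = trans (cong ℕ.suc position) (sym (length-∷ʳ ws x))

-- Register 2 is the next output position, 3 the vertex read, 4 its colour and
-- 5 a counter; array 3 counts the occurrences of each vertex.
copyOccurrence copyEdge copyEdges : Program
copyOccurrence = 3 ≔ 1 [ 2 ] ⨾ 4 ≔ 0 [ 3 ] ⨾ 2 [ 2 ]≔ 4 ⨾ 5 ≔ 3 [ 3 ] ⨾ 5 ≔ inc 5 ⨾ 3 [ 3 ]≔ 5 ⨾ 2 ≔ inc 2
copyEdge       = copyOccurrence ⨾ copyOccurrence ⨾ copyOccurrence ⨾ 1 ≔ dec 1
copyEdges      = while 1 copyEdge

-- Register 6 is the current vertex and 7 the colour opposite to its own.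
flip fillLink fillVertex fillVertices colour : Program
flip         = ifnz 4 (7 ≔ const 0) (7 ≔ const 1)
fillLink     = 2 [ 2 ]≔ 4 ⨾ 2 ≔ inc 2 ⨾ 2 [ 2 ]≔ 7 ⨾ 2 ≔ inc 2 ⨾ 2 [ 2 ]≔ 7 ⨾ 2 ≔ inc 2 ⨾ 5 ≔ dec 5
fillVertex   = 4 ≔ 0 [ 6 ] ⨾ flip ⨾ 5 ≔ 3 [ 6 ] ⨾ 5 ≔ dec 5 ⨾ while 5 fillLink ⨾ 6 ≔ inc 6 ⨾ 0 ≔ dec 0
fillVertices = while 0 fillVertex
colour       = copyEdges ⨾ fillVertices

-- Correctness and running time

module Run (H : Hypergraph) (χ : Colouring H) where
  occurrencesOf : Fin (#V H) → List (Occurrence H) → ℕ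
  occurrencesOf v os = List.length (List.filter (λ o → vertexAt H o Fin.≟ v) os)

  colourAt : Occurrence H → ℕ
  colourAt o = toℕ (χ (vertexAt H o))

  -- Invariant of the first loop, with `k` hyperedges left. Register 6 is tracked although the loop
  -- never touches it, as the second loop starts its scan of the vertices there.
  record Copied (done : List (Occurrence H)) (k : ℕ) (s : State) : Set where
    field
      vertices  : regs s 0 ≡ #V H
      remaining : regs s 1 ≡ k
      current   : regs s 6 ≡ 0
      colours   : arrs s 0 ≡ arrs (input H χ) 0
      edges     : arrs s 1 ≡ arrs (input H χ) 1
      output    : Written (List.map colourAt done) s
      counts    : ∀ v → arrs s 3 (toℕ v) ≡ occurrencesOf v done

    position : regs s 2 ≡ List.length done
    position = trans (Written.position output) (List.length-map colourAt done)

  read-vertex : ∀ o → arrs (input H χ) 1 (toℕ (uncurry combine o)) ≡ toℕ (vertexAt H o)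
  read-vertex (e , j) = trans (cells-toℕ (toℕ ∘ vertexAt H ∘ remQuot {#E H} 3) (combine e j))
    (cong (toℕ ∘ vertexAt H) (Fin.remQuot-combine e j))

  -- Register 2 is both the reading position in array 1 and the writing position in array 2: a copy
  -- has the same number in the compilation as its occurrence has in the input. The assumption on
  -- the length of `done` places the register there.
  copyOccurrence-runs : ∀ {done k s} o → List.length done ≡ toℕ (uncurry combine o) → Copied done k s →
    ∃ λ s′ → (s ⊢ copyOccurrence ⇓ s′ ▷ 7) × Copied (done ∷ʳ o) k s′
  copyOccurrence-runs {done} {k} {s} o at I = _
    , run-seq run-assign (run-seq run-assign (run-seq run-store (run-seq run-assign
        (run-seq run-assign (run-seq run-store run-assign)))))
    , record
      { vertices  = vertices
      ; remaining = remaining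
      ; current   = current
      ; colours   = colours
      ; edges     = edges
      ; output    = subst (λ ws → Written ws _) (sym (List.map-++ colourAt done (o ∷ []))) (record
          { position = Written.advance output (colourAt o)
          ; written  = λ i → trans (cong (λ x → (arrs s 2 [ regs s 2 ↦ x ]) i) c≡) (Written.append output (colourAt o) i)
          })
      ; counts    = counts′
      }
    where
    open Copied I
    v = arrs s 1 (regs s 2)
    v≡ : v ≡ toℕ (vertexAt H o)
    v≡ = trans (cong₂ (λ a p → a p) edges (trans position at)) (read-vertex o)
    c≡ : arrs s 0 v ≡ colourAt o
    c≡ = trans (cong₂ (λ a p → a p) colours v≡) (cells-toℕ (toℕ ∘ χ) (vertexAt H o))
    counts′ : ∀ u → (arrs s 3 [ v ↦ ℕ.suc (arrs s 3 v) ]) (toℕ u) ≡ occurrencesOf u (done ∷ʳ o)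
    counts′ u = trans (update (vertexAt H o Fin.≟ u)) (sym (length-filter-∷ʳ (λ o → vertexAt H o Fin.≟ u) done o))
      where
      update : (d : Dec (vertexAt H o ≡ u)) →
        (arrs s 3 [ v ↦ ℕ.suc (arrs s 3 v) ]) (toℕ u) ≡ occurrencesOf u done ℕ.+ indicator d
      update (yes refl) = trans (↦-same (arrs s 3) _ (sym v≡))
        (trans (cong ℕ.suc (trans (cong (arrs s 3) v≡) (counts u))) (ℕ.+-comm 1 _))
      update (no ≢u)    = trans (↦-other (arrs s 3) _ (λ eq → ≢u (Fin.toℕ-injective (sym (trans eq v≡)))))
        (trans (counts u) (sym (ℕ.+-identityʳ _)))


  copyEdge-runs : ∀ {done k s} e → List.length done ≡ 3 ℕ.* toℕ e → Copied done (ℕ.suc k) s →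
    ∃ λ s′ → (s ⊢ copyEdge ⇓ s′ ▷ 22) × Copied (done ∷ʳ (e , 0F) ∷ʳ (e , 1F) ∷ʳ (e , 2F)) k s′
  copyEdge-runs {done} {k} e at I =
    let at₀ = trans at (sym (ℕ.+-identityʳ _))
        at₁ = next done at₀
        at₂ = next (done ∷ʳ (e , 0F)) at₁
        s₀ , r₀ , I₀ = copyOccurrence-runs (e , 0F) (trans at₀ (sym (Fin.toℕ-combine e 0F))) I
        s₁ , r₁ , I₁ = copyOccurrence-runs (e , 1F) (trans at₁ (sym (Fin.toℕ-combine e 1F))) I₀
        s₂ , r₂ , I₂ = copyOccurrence-runs (e , 2F) (trans at₂ (sym (Fin.toℕ-combine e 2F))) I₁
    in _ , run-seq r₀ (run-seq r₁ (run-seq r₂ run-assign)) , decrement I₂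
    where
    next : ∀ os {o : Occurrence H} {a} → List.length os ≡ 3 ℕ.* toℕ e ℕ.+ a →
           List.length (os ∷ʳ o) ≡ 3 ℕ.* toℕ e ℕ.+ ℕ.suc a
    next os {o} h = trans (length-∷ʳ os o) (trans (cong ℕ.suc h) (sym (ℕ.+-suc _ _)))
    decrement : ∀ {os s} → Copied os (ℕ.suc k) s → Copied os k (assign 1 (dec 1) s)
    decrement J = record
      { vertices  = vertices
      ; remaining = cong ℕ.pred remaining
      ; current   = current
      ; colours   = colours
      ; edges     = edges
      ; output    = record { position = Written.position output ; written = Written.written output }
      ; counts    = counts
      }
      where open Copied J

  -- The function `f` lists the remaining hyperedges, starting at number `k`; it is general because
  -- the tail of `allFin` is tabulated by a shifted function. A round takes 22 steps and a test, and
  -- the exit one more test.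
  copyEdges-runs : ∀ n (f : Fin n → Fin (#E H)) {k done s} → (∀ i → toℕ (f i) ≡ k ℕ.+ toℕ i) →
    List.length done ≡ 3 ℕ.* k → Copied done n s →
    ∃ λ s′ → (s ⊢ copyEdges ⇓ s′ ▷ (n ℕ.* 23 ℕ.+ 1))
           × Copied (done ++ List.cartesianProduct (List.tabulate f) (List.allFin 3)) 0 s′
  copyEdges-runs ℕ.zero f {done = done} _ _ I =
    _ , run-exit (Copied.remaining I) , subst (λ os → Copied os 0 _) (sym (List.++-identityʳ done)) I
  copyEdges-runs (ℕ.suc n) f {k} {done} f≡ at I =
    let e = f zero
        _ , r , J = copyEdge-runs {done} e (trans at (cong (3 ℕ.*_) (sym (trans (f≡ zero) (ℕ.+-identityʳ k))))) I
        s′ , r′ , K = copyEdges-runs n (f ∘ suc) {ℕ.suc k} (λ i → trans (f≡ (suc i)) (ℕ.+-suc k (toℕ i))) (at′ e) J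
    in s′ , run-loop (λ eq → contradiction (trans (sym (Copied.remaining I)) eq) λ ()) r r′
         , subst (λ os → Copied os 0 s′) (reassociate e) K
    where
    rest = List.cartesianProduct (List.tabulate (f ∘ suc)) (List.allFin 3)
    at′ : ∀ e → List.length (done ∷ʳ (e , 0F) ∷ʳ (e , 1F) ∷ʳ (e , 2F)) ≡ 3 ℕ.* ℕ.suc k
    at′ e = begin
      List.length (done ∷ʳ (e , 0F) ∷ʳ (e , 1F) ∷ʳ (e , 2F)) ≡⟨ length-∷ʳ (done ∷ʳ (e , 0F) ∷ʳ (e , 1F)) (e , 2F) ⟩
      1 ℕ.+ List.length (done ∷ʳ (e , 0F) ∷ʳ (e , 1F))       ≡⟨ cong ℕ.suc (length-∷ʳ (done ∷ʳ (e , 0F)) (e , 1F)) ⟩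
      2 ℕ.+ List.length (done ∷ʳ (e , 0F))                   ≡⟨ cong (2 ℕ.+_) (length-∷ʳ done (e , 0F)) ⟩
      3 ℕ.+ List.length done                                 ≡⟨ cong (3 ℕ.+_) at ⟩
      3 ℕ.+ 3 ℕ.* k                                          ≡⟨ ℕ.*-suc 3 k ⟨
      3 ℕ.* ℕ.suc k ∎
      where open ≡-Reasoning
    reassociate : ∀ e → (done ∷ʳ (e , 0F) ∷ʳ (e , 1F) ∷ʳ (e , 2F)) ++ rest ≡ done ++ (e , 0F) ∷ (e , 1F) ∷ (e , 2F) ∷ rest
    reassociate e = trans (List.++-assoc (done ∷ʳ (e , 0F) ∷ʳ (e , 1F)) _ rest)
      (trans (List.++-assoc (done ∷ʳ (e , 0F)) _ ((e , 2F) ∷ rest)) (List.++-assoc done _ ((e , 1F) ∷ (e , 2F) ∷ rest)))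

  allOccurrences : List (Occurrence H)
  allOccurrences = List.cartesianProduct (List.allFin (#E H)) (List.allFin 3)

  record Filled (ws : List ℕ) (v k : ℕ) (s : State) : Set where
    field
      remaining : regs s 0 ≡ k
      current   : regs s 6 ≡ v
      colours   : arrs s 0 ≡ arrs (input H χ) 0
      output    : Written ws s
      counts    : ∀ u → arrs s 3 (toℕ u) ≡ occurrencesOf u allOccurrences

  -- The auxiliary colours of `paint` for `k = 0F`: the program computes this one of the three
  -- expansions.
  block : Fin 2 → Vec ℕ 3
  block c = toℕ c ∷ toℕ (opposite c) ∷ toℕ (opposite c) ∷ []

  fillLinks-runs : ∀ m c {ws v k s} → regs s 4 ≡ toℕ c → regs s 7 ≡ toℕ (opposite c) → regs s 5 ≡ m → Filled ws v k s →
    ∃ λ s′ → (s ⊢ while 5 fillLink ⇓ s′ ▷ (m ℕ.* 8 ℕ.+ 1))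
           × Filled (ws ++ List.concat (List.replicate m (Vec.toList (block c)))) v k s′
  fillLinks-runs ℕ.zero c {ws} _ _ r5 I = _ , run-exit r5 , subst (λ ws → Filled ws _ _ _) (sym (List.++-identityʳ ws)) I
  fillLinks-runs (ℕ.suc m) c {ws} {v} {k} {s} r4 r7 r5 I =
    let s′ , r , J = fillLinks-runs m c {ws ∷ʳ x ∷ʳ y ∷ʳ y} r4 r7 (cong ℕ.pred r5) filled
    in s′ , run-loop (λ eq → contradiction (trans (sym r5) eq) λ ())
          (run-seq run-store (run-seq run-assign (run-seq run-store (run-seq run-assign (run-seq run-store
            (run-seq run-assign run-assign)))))) r
        , subst (λ ws → Filled ws v k s′) reassociate J
    where
    open Filled I
    x = toℕ c
    y = toℕ (opposite c)
    push : ℕ → State → State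
    push a s = assign 2 (inc 2) (store 2 2 a s)
    written : ∀ {ws s a z} → regs s a ≡ z → Written ws s → Written (ws ∷ʳ z) (push a s)
    written {ws} {s} refl W = record { position = Written.advance W _ ; written = Written.append W _ }
    filled : Filled (ws ∷ʳ x ∷ʳ y ∷ʳ y) v k (assign 5 (dec 5) (push 7 (push 7 (push 4 s))))
    filled = record
      { remaining = remaining
      ; current   = current
      ; colours   = colours
      ; output    = let W = written {a = 7} r7 (written {a = 7} r7 (written {a = 4} r4 output))
                    in record { position = Written.position W ; written = Written.written W }
      ; counts    = counts
      }
    rest = List.concat (List.replicate m (Vec.toList (block c)))
    reassociate : (ws ∷ʳ x ∷ʳ y ∷ʳ y) ++ rest ≡ ws ++ x ∷ y ∷ y ∷ rest
    reassociate = trans (List.++-assoc (ws ∷ʳ x ∷ʳ y) _ rest)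
      (trans (List.++-assoc (ws ∷ʳ x) _ (y ∷ rest)) (List.++-assoc ws _ (y ∷ y ∷ rest)))

  flip-runs : ∀ {s} (c : Fin 2) → regs s 4 ≡ toℕ c → s ⊢ flip ⇓ assign 7 (const (toℕ (opposite c))) s ▷ 2
  flip-runs 0F eq = run-else eq run-assign
  flip-runs 1F eq = run-then (λ eq′ → contradiction (trans (sym eq) eq′) λ ()) run-assign

  module _ (P : Arrangement H) where
    open Arrangement P
    open Compilation H P using (links; #L)

    linkBlock : Occurrence H × Occurrence H → Vec ℕ 3
    linkBlock (x , _) = block (χ (vertexAt H x))

    linksAt : Fin (#V H) → List (Occurrence H × Occurrence H)
    linksAt = consecutive ∘ path

    blocks : List (Occurrence H × Occurrence H) → List ℕ
    blocks = List.concatMap (Vec.toList ∘ linkBlock)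

    -- All links of one path start at copies of the same vertex, so the machine can repeat one
    -- block.
    blocks-replicate : ∀ {v} {ls : List (Occurrence H × Occurrence H)} →
      All (λ (x , _) → vertexAt H x ≡ v) ls → List.concat (List.replicate (List.length ls) (Vec.toList (block (χ v)))) ≡ blocks ls
    blocks-replicate []          = refl
    blocks-replicate {v} (refl ∷ ps) = cong (Vec.toList (block (χ v)) ++_) (blocks-replicate ps)

    -- Here the arrangement drops out: a path is a permutation of the occurrences, so the count in
    -- array 3, less one, is the number of blocks to write.
    #linksAt : ∀ v → List.length (linksAt v) ≡ ℕ.pred (occurrencesOf v allOccurrences)
    #linksAt v = trans (consecutive-length (path v)) (cong ℕ.pred (↭.↭-length (path-↭ v)))

    -- Each link costs seven instructions and a test. The other 8 steps are the load of the colour,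
    -- two for `flip`, two for the counter, the exit test and two register updates.
    fillVertex-runs : ∀ {ws k s} v → Filled ws (toℕ v) (ℕ.suc k) s →
      ∃ λ s′ → (s ⊢ fillVertex ⇓ s′ ▷ (List.length (linksAt v) ℕ.* 8 ℕ.+ 8)) × Filled (ws ++ blocks (linksAt v)) (ℕ.suc (toℕ v)) k s′
    fillVertex-runs {ws} {k} {s} v I =
      let s′ , r , J = fillLinks-runs (List.length (linksAt v)) (χ v) colour≡ refl count≡ started
      in assign 0 (dec 0) (assign 6 (inc 6) s′) , subst (s ⊢ fillVertex ⇓ assign 0 (dec 0) (assign 6 (inc 6) s′) ▷_) (time (List.length (linksAt v)))
               (run-seq run-assign (run-seq (flip-runs (χ v) colour≡) (run-seq run-assign (run-seq run-assign
                 (run-seq r (run-seq run-assign run-assign))))))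
           , finish (subst (λ bs → Filled (ws ++ bs) (toℕ v) (ℕ.suc k) s′) (blocks-replicate (All.map proj₁ (Compiled.ends-at H P v))) J)
      where
      open Filled I
      started : Filled ws (toℕ v) (ℕ.suc k)
        (assign 5 (dec 5) (assign 5 (3 [ 6 ]) (assign 7 (const (toℕ (opposite (χ v)))) (assign 4 (0 [ 6 ]) s))))
      started = record { remaining = remaining ; current = current ; colours = colours
        ; output = record { position = Written.position output ; written = Written.written output } ; counts = counts }
      colour≡ : arrs s 0 (regs s 6) ≡ toℕ (χ v)
      colour≡ = trans (cong₂ (λ a p → a p) colours current) (cells-toℕ (toℕ ∘ χ) v)
      count≡ : ℕ.pred (arrs s 3 (regs s 6)) ≡ List.length (linksAt v)
      count≡ = trans (cong ℕ.pred (trans (cong (arrs s 3) current) (counts v))) (sym (#linksAt v))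
      time : ∀ m → 1 ℕ.+ (2 ℕ.+ (1 ℕ.+ (1 ℕ.+ ((m ℕ.* 8 ℕ.+ 1) ℕ.+ 2)))) ≡ m ℕ.* 8 ℕ.+ 8
      time m = solve 1 (λ m → con 5 :+ ((m :* con 8 :+ con 1) :+ con 2) := m :* con 8 :+ con 8) refl m
        where open Data.Nat.Solver.+-*-Solver
      finish : ∀ {ws s} → Filled ws (toℕ v) (ℕ.suc k) s → Filled ws (ℕ.suc (toℕ v)) k (assign 0 (dec 0) (assign 6 (inc 6) s))
      finish K = record { remaining = cong ℕ.pred (Filled.remaining K) ; current = cong ℕ.suc (Filled.current K)
        ; colours = Filled.colours K ; counts = Filled.counts K
        ; output = let W = Filled.output K in record { position = Written.position W ; written = Written.written W } }

    fillVertices-runs : ∀ n (f : Fin n → Fin (#V H)) {k ws s} → (∀ i → toℕ (f i) ≡ k ℕ.+ toℕ i) → Filled ws k n s →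
      let ls = List.concatMap linksAt (List.tabulate f) in
      ∃ λ s′ → (s ⊢ fillVertices ⇓ s′ ▷ (List.length ls ℕ.* 8 ℕ.+ (n ℕ.* 9 ℕ.+ 1))) × Written (ws ++ blocks ls) s′
    fillVertices-runs ℕ.zero f {ws = ws} _ I = _ , run-exit (Filled.remaining I)
      , subst (λ ws → Written ws _) (sym (List.++-identityʳ ws)) (Filled.output I)
    fillVertices-runs (ℕ.suc n) f {k} {ws} {s} f≡ I =
      let v = f zero
          v≡ = trans (f≡ zero) (ℕ.+-identityʳ k)
          s₁ , r , J = fillVertex-runs v (subst (λ k → Filled ws k (ℕ.suc n) s) (sym v≡) I)
          s′ , r′ , W = fillVertices-runs n (f ∘ suc) {ℕ.suc k} (λ i → trans (f≡ (suc i)) (ℕ.+-suc k (toℕ i)))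
                         (subst (λ v → Filled (ws ++ blocks (linksAt (f zero))) (ℕ.suc v) n s₁) v≡ J)
      in s′ , subst (s ⊢ fillVertices ⇓ s′ ▷_) (time (linksAt v) rest)
                (run-loop (λ eq → contradiction (trans (sym (Filled.remaining I)) eq) λ ()) r r′)
            , subst (λ ws → Written ws s′)
                (trans (List.++-assoc ws (blocks (linksAt v)) (blocks rest))
                  (cong (ws ++_) (sym (List.concatMap-++ (Vec.toList ∘ linkBlock) (linksAt v) rest)))) W
      where
      rest = List.concatMap linksAt (List.tabulate (f ∘ suc))
      time : ∀ (ls ms : List (Occurrence H × Occurrence H)) →
        ℕ.suc ((List.length ls ℕ.* 8 ℕ.+ 8) ℕ.+ (List.length ms ℕ.* 8 ℕ.+ (n ℕ.* 9 ℕ.+ 1)))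
          ≡ List.length (ls ++ ms) ℕ.* 8 ℕ.+ (ℕ.suc n ℕ.* 9 ℕ.+ 1)
      time ls ms rewrite List.length-++ ls {ms} =
        solve 3 (λ a b n → con 1 :+ ((a :* con 8 :+ con 8) :+ (b :* con 8 :+ (n :* con 9 :+ con 1)))
                        := (a :+ b) :* con 8 :+ (con 9 :+ n :* con 9 :+ con 1)) refl (List.length ls) (List.length ms) n
        where open Data.Nat.Solver.+-*-Solver

    colour-runs : ∃ λ s → (input H χ ⊢ colour ⇓ s ▷ (#E H ℕ.* 23 ℕ.+ 1 ℕ.+ (#L ℕ.* 8 ℕ.+ (#V H ℕ.* 9 ℕ.+ 1))))
                       × Written (List.map colourAt allOccurrences ++ blocks links) s
    colour-runs =
      let _ , r , I = copyEdges-runs (#E H) id {0} {[]} (λ _ → refl) refl initial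
          s , r′ , W = fillVertices-runs (#V H) id {0} (λ _ → refl) (handover I)
      in s , run-seq r r′ , W
      where
      initial : Copied [] (#E H) (input H χ)
      initial = record { vertices = refl ; remaining = refl ; current = refl ; colours = refl ; edges = refl
        ; output = record { position = refl ; written = λ _ → refl } ; counts = λ _ → refl }
      handover : ∀ {s} → Copied allOccurrences 0 s → Filled (List.map colourAt allOccurrences) 0 (#V H) s
      handover I = record { remaining = vertices ; current = current ; colours = colours ; output = output ; counts = counts }
        where open Copied I

    -- As there are at most three links per hyperedge, the time is at most 47 per hyperedge, 9 per
    -- vertex and 2 more. A hyperedge counts 3 in `inputSize`, and 16 is the least `c` with 3c ≥ 47.
    time-bound : #E H ℕ.* 23 ℕ.+ 1 ℕ.+ (#L ℕ.* 8 ℕ.+ (#V H ℕ.* 9 ℕ.+ 1)) ℕ.≤ 16 ℕ.* inputSize H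
    time-bound = begin
      #E H ℕ.* 23 ℕ.+ 1 ℕ.+ (#L ℕ.* 8 ℕ.+ (#V H ℕ.* 9 ℕ.+ 1))
        ≤⟨ ℕ.+-monoʳ-≤ (#E H ℕ.* 23 ℕ.+ 1) (ℕ.+-monoˡ-≤ (#V H ℕ.* 9 ℕ.+ 1) (ℕ.*-monoˡ-≤ 8 (Compiled.#L≤ H P))) ⟩
      #E H ℕ.* 23 ℕ.+ 1 ℕ.+ (#E H ℕ.* 3 ℕ.* 8 ℕ.+ (#V H ℕ.* 9 ℕ.+ 1))
        -- The summand is the exact slack between the two sides.
        ≤⟨ ℕ.m≤m+n _ (30 ℕ.+ #V H ℕ.* 7 ℕ.+ #E H) ⟩
      (#E H ℕ.* 23 ℕ.+ 1 ℕ.+ (#E H ℕ.* 3 ℕ.* 8 ℕ.+ (#V H ℕ.* 9 ℕ.+ 1))) ℕ.+ (30 ℕ.+ #V H ℕ.* 7 ℕ.+ #E H)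
        ≡⟨ solve 2 (λ e v → (e :* con 23 :+ con 1 :+ (e :* con 3 :* con 8 :+ (v :* con 9 :+ con 1))) :+ (con 30 :+ v :* con 7 :+ e)
                         := con 16 :* (con 2 :+ v :+ e :* con 3)) refl (#E H) (#V H) ⟩
      16 ℕ.* inputSize H ∎
      where
      open ℕ.≤-Reasoning
      open Data.Nat.Solver.+-*-Solver

    open Compilation H P using (Vertex; copy; aux)
    open Compiled H P using (first)
    open Mixtures H P using (expand; expand-copy; expand-slot)

    data VertexView : Vertex → Set where
      isCopy : ∀ o → VertexView (copy o)
      isAux  : ∀ l k → VertexView (aux l k)

    vertexView : ∀ v → VertexView v
    vertexView v with splitAt (#E H ℕ.* 3) v in eq
    ... | inj₁ i = subst VertexView
      (trans (cong (_↑ˡ (#L ℕ.* 3)) (Fin.combine-remQuot {#E H} 3 i)) (Fin.splitAt⁻¹-↑ˡ eq)) (isCopy (remQuot 3 i))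
    ... | inj₂ i = subst VertexView
      (trans (cong ((#E H ℕ.* 3) ↑ʳ_) (Fin.combine-remQuot {#L} 3 i)) (Fin.splitAt⁻¹-↑ʳ eq)) (uncurry isAux (remQuot 3 i))

    edgeBlock : Fin (#E H) → Vec ℕ 3
    edgeBlock e = Vec.tabulate λ j → colourAt (e , j)

    edgeBlocks : ∀ es → List.map colourAt (List.cartesianProduct es (List.allFin 3)) ≡ List.concatMap (Vec.toList ∘ edgeBlock) es
    edgeBlocks []       = refl
    edgeBlocks (e ∷ es) = cong (λ zs → Vec.toList (edgeBlock e) ++ zs) (edgeBlocks es)

    length-edgeBlocks : ∀ {n} (f : Fin n → Fin (#E H)) → List.length (List.concatMap (Vec.toList ∘ edgeBlock) (List.tabulate f)) ≡ n ℕ.* 3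
    length-edgeBlocks {ℕ.zero}  f = refl
    length-edgeBlocks {ℕ.suc n} f = cong (3 ℕ.+_) (length-edgeBlocks (f ∘ suc))

    -- The order of writing is the numbering of the compiled vertices: copies hyperedge by
    -- hyperedge, then three auxiliary vertices per link. The links are numbered vertex by vertex,
    -- just as the second loop visits them.
    outputs : ∀ {s} → Written (List.map colourAt allOccurrences ++ blocks links) s → Outputs (compiled H P) s (expand 0F χ)
    outputs {s} W v = trans (Written.written W (toℕ v))
      (trans (cong (λ xs → contents (xs ++ blocks links) (toℕ v)) (edgeBlocks (List.allFin (#E H)))) (value (vertexView v)))
      where
      open ≡-Reasoning
      copies = List.concatMap (Vec.toList ∘ edgeBlock) (List.allFin (#E H))
      block≡ : ∀ c k → Vec.lookup (block c) k ≡ toℕ (paint c 0F (suc (suc k)))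
      block≡ c 0F = refl
      block≡ c 1F = refl
      block≡ c 2F = refl
      value : ∀ {v} → VertexView v → contents (copies ++ blocks links) (toℕ v) ≡ toℕ (expand 0F χ v)
      value (isCopy o@(e , j)) = begin
        contents (copies ++ blocks links) (toℕ (copy o))          ≡⟨ cong (contents (copies ++ blocks links)) (Fin.toℕ-↑ˡ (combine e j) (#L ℕ.* 3)) ⟩
        contents (copies ++ blocks links) (toℕ (combine e j))     ≡⟨ contents-blocks edgeBlock id (blocks links) e j ⟩
        Vec.lookup (edgeBlock e) j                                ≡⟨ Vec.lookup∘tabulate (λ j → colourAt (e , j)) j ⟩
        colourAt o                                                ≡⟨ cong toℕ (expand-copy 0F χ o) ⟨
        toℕ (expand 0F χ (copy o)) ∎
      value (isAux l k) = begin
        contents (copies ++ blocks links) (toℕ (aux l k))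
          ≡⟨ cong (contents (copies ++ blocks links)) (trans (Fin.toℕ-↑ʳ (#E H ℕ.* 3) (combine l k))
               (cong (ℕ._+ toℕ (combine l k)) (sym (length-edgeBlocks id)))) ⟩
        contents (copies ++ blocks links) (List.length copies ℕ.+ toℕ (combine l k))
          ≡⟨ contents-++ʳ copies (blocks links) (toℕ (combine l k)) ⟩
        contents (blocks links) (toℕ (combine l k))
          -- The list of links is presented as a tabulation followed by `[]`, the form that
          -- `contents-blocks` expects.
          ≡⟨ cong (λ xs → contents xs (toℕ (combine l k))) (sym (trans (List.++-identityʳ _) (cong blocks (List.tabulate-lookup links)))) ⟩
        contents (blocks (List.tabulate (List.lookup links)) ++ []) (toℕ (combine l k))
          ≡⟨ contents-blocks linkBlock (List.lookup links) [] l k ⟩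
        Vec.lookup (linkBlock (List.lookup links l)) k
          ≡⟨ block≡ (χ (vertexAt H (first l))) k ⟩
        toℕ (paint (χ (vertexAt H (first l))) 0F (suc (suc k)))
          ≡⟨ cong toℕ (expand-slot 0F χ l (suc (suc k))) ⟨
        toℕ (expand 0F χ (aux l k)) ∎

theorem5p9 : ((H : Hypergraph) → ThreeUniform H → (ni : NoIsolated H) → (P : Arrangement H) →
    ((nz : NonZero (#E H)) →
    NCF (naeModel (compiled H P) (compiled-noIsolated H P) (compiled-nonZero H P nz))
    ≡ NCF (naeModel H ni nz))
    × Simple (compiled H P)
    × ThreeUniform (compiled H P)
    × ((o : Occurrence H) → degree (compiled H P) (Compilation.copy H P o) ≤ 7)
    × ((l : Fin (Compilation.#L H P)) (k : Fin 3) →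
    degree (compiled H P) (Compilation.aux H P l k) ≡ 4))
    × ∃ λ (colour : Program) → ∃ λ (c : ℕ) →
    (H : Hypergraph) → ThreeUniform H → NoIsolated H → (P : Arrangement H) →
    (χ : Colouring H) → Proper H χ →
    ∃ λ (s : State) → ∃ λ (t : ℕ) → ∃ λ (χ′ : Colouring (compiled H P)) →
    (input H χ ⊢ colour ⇓ s ▷ t)
    × t ≤ c * inputSize H
    × Proper (compiled H P) χ′
    × Outputs (compiled H P) s χ′
theorem5p9 =
    (λ H _ ni P →
        Mixtures.NCF-compiled H P ni
      , Compiled.compiled-simple H P
      , Compiled.compiled-uniform H P
      , Compiled.degree-copy H P
      , Compiled.degree-aux H P)
  , colour , 16 , λ H _ _ P χ proper →
      let (s , run , written) = Run.colour-runs H χ P in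
        s , _ , Mixtures.expand H P 0F χ
      , run
      , Run.time-bound H χ P
      , nae⇒proper (Mixtures.expand-nae H P 0F χ (proper⇒nae proper))
      , Run.outputs H χ P written
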